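{- Assume there is a proper class of supercompact cardinals. Then for every ring $R$ and every set $\mathcal{S}$ of $R$-modules, the class ${}^\perp\mathcal{S}$ is a Kaplansky class.
   Context: The background theory is ZFC. Modules are left $R$-modules. For a class (in particular, a set) $\mathcal{C}$ of $R$-modules, ${}^\perp\mathcal{C}=\{X : \mathrm{Ext}^1_R(X,C)=0 \text{ for all } C\in\mathcal{C}\}$. A class $\mathcal{C}$ of modules is a Kaplansky class if there exists a cardinal $\kappa$ such that, for every $C\in\mathcal{C}$ and every subset $X\subseteq C$ with $|X|<\kappa$, there is a $<\kappa$-presented submodule $C_0$ of $C$ such that $X\subseteq C_0$ and both $C_0$ and $C/C_0$ are in $\mathcal{C}$. A module is $<\kappa$-presented if it has a presentation with fewer than $\kappa$ generators and fewer than $\kappa$ relations. -}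

module Defs where

open import Algebra.Bundles using (CommutativeMonoid; Ring)
open import Algebra.Module.Bundles using (LeftModule)
open import Algebra.Module.Construct.DirectProduct using (leftModule)
open import Algebra.Module.Morphism.Structures using (module LeftModuleMorphisms)
import Algebra.Properties.AbelianGroup as AbelianGroupProperties
import Algebra.Properties.CommutativeSemigroup as CommutativeSemigroupProperties
open import Data.Bool.Base using (Bool; T)
open import Data.Empty.Polymorphic using (⊥)
open import Data.Nat.Base using (ℕ)
open import Data.Product.Base using (Σ; ∃; _×_; _,_; proj₁; proj₂)
open import Data.Refinement using (Refinement-syntax; value)
open import Data.Sum.Base using (_⊎_)
open import Function.Base using (_on_)
open import Function.Bundles using (Injection; _⇔_)
open import Function.Definitions using (Surjective)
open import Level using (Level; Lift; _⊔_; suc)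
open import Relation.Binary.Bundles using (Setoid)
import Relation.Binary.Construct.On as On
open import Relation.Binary.Definitions using (_Respects_)
open import Relation.Binary.PropositionalEquality using (_≡_; setoid)
open import Relation.Nullary.Negation using (¬_)
open import Relation.Unary using (Pred; _⊆_; ∁; ⋂)
import Relation.Binary.Reasoning.Setoid as ≈-Reasoning

private
  variable
    a b i p ℓ ℓ₁ ℓ₂ : Level

------------------------------------------------------------------------
-- Cardinals
--
-- The sets of the ambient universe of set theory are the types (and
-- setoids) of a fixed level ℓ.  A cardinal is given by any type having
-- that cardinality.  The cardinality of a setoid is that of its
-- quotient.

infix 4 _≼_ _≺_

_≼_ : Setoid a ℓ₁ → Setoid b ℓ₂ → Set (a ⊔ ℓ₁ ⊔ b ⊔ ℓ₂)
A ≼ B = Injection A B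

_≺_ : Setoid a ℓ₁ → Setoid b ℓ₂ → Set (a ⊔ ℓ₁ ⊔ b ⊔ ℓ₂)
A ≺ B = A ≼ B × ¬ (B ≼ A)

IsInfinite : Set ℓ → Set ℓ
IsInfinite κ = setoid ℕ ≼ setoid κ

IsUncountable : Set ℓ → Set ℓ
IsUncountable κ = setoid ℕ ≺ setoid κ

------------------------------------------------------------------------
-- Supercompact cardinals, via normal measures on 𝒫<κ(A)

-- Subsets of A are Boolean-valued, so that under function
-- extensionality equal subsets are propositionally equal; the
-- smallness proof is irrelevant for the same reason.
𝒫< : Set ℓ → Set ℓ → Set ℓ
𝒫< κ A = [ x ∈ (A → Bool) ∣ setoid (∃ λ e → T (x e)) ≺ setoid κ ]

record NormalMeasure {ℓ} (κ A : Set ℓ) : Set (suc ℓ) where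
  field
    U        : Pred (Pred (𝒫< κ A) ℓ) ℓ
    upward   : ∀ {X Y : Pred (𝒫< κ A) ℓ} → X ⊆ Y → U X → U Y
    proper   : ¬ U (λ _ → ⊥)
    ultra    : ∀ X → U X ⊎ U (∁ X)
    complete : ∀ (I : Set ℓ) → setoid I ≺ setoid κ →
               (X : I → Pred (𝒫< κ A) ℓ) → (∀ i → U (X i)) → U (⋂ I X)
    fine     : ∀ e → U (λ x → Lift ℓ (T (value x e)))
    normal   : ∀ (f : 𝒫< κ A → A) →
               U (λ x → Lift ℓ (T (value x (f x)))) →
               ∃ λ e → U (λ x → f x ≡ e)

IsSupercompact : Set ℓ → Set (suc ℓ)
IsSupercompact {ℓ} κ =
  IsUncountable κ × (∀ (A : Set ℓ) → setoid κ ≼ setoid A → NormalMeasure κ A)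

ProperClassOfSupercompacts : ∀ ℓ → Set (suc ℓ)
ProperClassOfSupercompacts ℓ =
  ∀ (A : Set ℓ) → ∃ λ (κ : Set ℓ) → IsSupercompact κ × setoid A ≺ setoid κ

------------------------------------------------------------------------
-- Left R-modules

module _ {ℓ} {R : Ring ℓ ℓ} where

  open LeftModule using (Carrierᴹ; rawLeftModule)

  module _ (M N : LeftModule R ℓ ℓ) where
    open LeftModuleMorphisms (rawLeftModule M) (rawLeftModule N) public
      using ()
      renaming ( IsLeftModuleHomomorphism to IsHom
               ; IsLeftModuleMonomorphism to IsMono
               ; IsLeftModuleIsomorphism  to IsIso )

  _≅_ : LeftModule R ℓ ℓ → LeftModule R ℓ ℓ → Set ℓ
  M ≅ N = ∃ λ (f : Carrierᴹ M → Carrierᴹ N) → IsIso M N f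

  ----------------------------------------------------------------------
  -- Submodules and quotients

  record Submodule (M : LeftModule R ℓ ℓ) : Set (suc ℓ) where
    open LeftModule M using (_≈ᴹ_; _+ᴹ_; _*ₗ_; 0ᴹ; -ᴹ_)
    field
      Member    : Pred (Carrierᴹ M) ℓ
      respects  : Member Respects _≈ᴹ_
      0-closed  : Member 0ᴹ
      +-closed  : ∀ {x y} → Member x → Member y → Member (x +ᴹ y)
      neg-closed : ∀ {x} → Member x → Member (-ᴹ x)
      *-closed  : ∀ r {x} → Member x → Member (r *ₗ x)

  module _ {M : LeftModule R ℓ ℓ} (P : Submodule M) where
    open LeftModule M hiding (Carrierᴹ; rawLeftModule)
    open Submodule P
    open AbelianGroupProperties +ᴹ-abelianGroup
      using (⁻¹-∙-comm; ⁻¹-involutive; inverseʳ-unique)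
    open CommutativeSemigroupProperties
      (CommutativeMonoid.commutativeSemigroup +ᴹ-commutativeMonoid)
      using (interchange)
    open ≈-Reasoning ≈ᴹ-setoid

    submodule : LeftModule R ℓ ℓ
    submodule = record
      { Carrierᴹ = Σ (Carrierᴹ M) Member
      ; _≈ᴹ_ = _≈ᴹ_ on proj₁
      ; _+ᴹ_ = λ (x , p) (y , q) → x +ᴹ y , +-closed p q
      ; _*ₗ_ = λ r (x , p) → r *ₗ x , *-closed r p
      ; 0ᴹ = 0ᴹ , 0-closed
      ; -ᴹ_ = λ (x , p) → -ᴹ x , neg-closed p
      ; isLeftModule = record
        { isLeftSemimodule = record
          { +ᴹ-isCommutativeMonoid = record
            { isMonoid = record
              { isSemigroup = record
                { isMagma = record
                  { isEquivalence = On.isEquivalence proj₁ ≈ᴹ-isEquivalence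
                  ; ∙-cong = +ᴹ-cong
                  }
                ; assoc = λ (x , _) (y , _) (z , _) → +ᴹ-assoc x y z
                }
              ; identity = (λ (x , _) → +ᴹ-identityˡ x)
                         , (λ (x , _) → +ᴹ-identityʳ x)
              }
            ; comm = λ (x , _) (y , _) → +ᴹ-comm x y
            }
          ; isPreleftSemimodule = record
            { *ₗ-cong = *ₗ-cong
            ; *ₗ-zeroˡ = λ (x , _) → *ₗ-zeroˡ x
            ; *ₗ-distribʳ = λ (x , _) r s → *ₗ-distribʳ x r s
            ; *ₗ-identityˡ = λ (x , _) → *ₗ-identityˡ x
            ; *ₗ-assoc = λ r s (x , _) → *ₗ-assoc r s x
            ; *ₗ-zeroʳ = *ₗ-zeroʳ
            ; *ₗ-distribˡ = λ r (x , _) (y , _) → *ₗ-distribˡ r x y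
            }
          }
        ; -ᴹ‿cong = -ᴹ‿cong
        ; -ᴹ‿inverse = (λ (x , _) → -ᴹ‿inverseˡ x)
                     , (λ (x , _) → -ᴹ‿inverseʳ x)
        }
      }

    private
      infix 4 _∼_

      _∼_ : Carrierᴹ M → Carrierᴹ M → Set ℓ
      x ∼ y = Member (x +ᴹ -ᴹ y)

      ≈⇒∼ : ∀ {x y} → x ≈ᴹ y → x ∼ y
      ≈⇒∼ {x} {y} eq = respects
        (≈ᴹ-sym (≈ᴹ-trans (+ᴹ-congʳ eq) (-ᴹ‿inverseʳ y))) 0-closed

      neg-diff : ∀ x y → -ᴹ (x +ᴹ -ᴹ y) ≈ᴹ y +ᴹ -ᴹ x
      neg-diff x y = begin
        -ᴹ (x +ᴹ -ᴹ y)       ≈⟨ ⁻¹-∙-comm x (-ᴹ y) ⟨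
        -ᴹ x +ᴹ -ᴹ (-ᴹ y)    ≈⟨ +ᴹ-congˡ (⁻¹-involutive y) ⟩
        -ᴹ x +ᴹ y            ≈⟨ +ᴹ-comm (-ᴹ x) y ⟩
        y +ᴹ -ᴹ x            ∎

      add-diff : ∀ x y z → (x +ᴹ -ᴹ y) +ᴹ (y +ᴹ -ᴹ z) ≈ᴹ x +ᴹ -ᴹ z
      add-diff x y z = begin
        (x +ᴹ -ᴹ y) +ᴹ (y +ᴹ -ᴹ z)   ≈⟨ +ᴹ-assoc x (-ᴹ y) (y +ᴹ -ᴹ z) ⟩
        x +ᴹ (-ᴹ y +ᴹ (y +ᴹ -ᴹ z))   ≈⟨ +ᴹ-congˡ (+ᴹ-assoc (-ᴹ y) y (-ᴹ z)) ⟨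
        x +ᴹ ((-ᴹ y +ᴹ y) +ᴹ -ᴹ z)   ≈⟨ +ᴹ-congˡ (+ᴹ-congʳ (-ᴹ‿inverseˡ y)) ⟩
        x +ᴹ (0ᴹ +ᴹ -ᴹ z)            ≈⟨ +ᴹ-congˡ (+ᴹ-identityˡ (-ᴹ z)) ⟩
        x +ᴹ -ᴹ z                    ∎

      sum-diff : ∀ x y u v →
                 (x +ᴹ -ᴹ y) +ᴹ (u +ᴹ -ᴹ v) ≈ᴹ (x +ᴹ u) +ᴹ -ᴹ (y +ᴹ v)
      sum-diff x y u v = begin
        (x +ᴹ -ᴹ y) +ᴹ (u +ᴹ -ᴹ v)   ≈⟨ interchange x (-ᴹ y) u (-ᴹ v) ⟩
        (x +ᴹ u) +ᴹ (-ᴹ y +ᴹ -ᴹ v)   ≈⟨ +ᴹ-congˡ (⁻¹-∙-comm y v) ⟩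
        (x +ᴹ u) +ᴹ -ᴹ (y +ᴹ v)      ∎

      *ₗ-neg : ∀ r y → r *ₗ (-ᴹ y) ≈ᴹ -ᴹ (r *ₗ y)
      *ₗ-neg r y = inverseʳ-unique (r *ₗ y) (r *ₗ (-ᴹ y)) (begin
        r *ₗ y +ᴹ r *ₗ (-ᴹ y)   ≈⟨ *ₗ-distribˡ r y (-ᴹ y) ⟨
        r *ₗ (y +ᴹ -ᴹ y)        ≈⟨ *ₗ-congˡ (-ᴹ‿inverseʳ y) ⟩
        r *ₗ 0ᴹ                 ≈⟨ *ₗ-zeroʳ r ⟩
        0ᴹ                      ∎)

      scale-diff : ∀ r x y → r *ₗ (x +ᴹ -ᴹ y) ≈ᴹ r *ₗ x +ᴹ -ᴹ (r *ₗ y)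
      scale-diff r x y = ≈ᴹ-trans (*ₗ-distribˡ r x (-ᴹ y)) (+ᴹ-congˡ (*ₗ-neg r y))

      ∼-sym : ∀ {x y} → x ∼ y → y ∼ x
      ∼-sym p = respects (neg-diff _ _) (neg-closed p)

      ∼-trans : ∀ {x y z} → x ∼ y → y ∼ z → x ∼ z
      ∼-trans p q = respects (add-diff _ _ _) (+-closed p q)

    quotient : LeftModule R ℓ ℓ
    quotient = record
      { Carrierᴹ = Carrierᴹ M
      ; _≈ᴹ_ = λ x y → Member (x +ᴹ -ᴹ y)
      ; _+ᴹ_ = _+ᴹ_
      ; _*ₗ_ = _*ₗ_
      ; 0ᴹ = 0ᴹ
      ; -ᴹ_ = -ᴹ_
      ; isLeftModule = record
        { isLeftSemimodule = record
          { +ᴹ-isCommutativeMonoid = record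
            { isMonoid = record
              { isSemigroup = record
                { isMagma = record
                  { isEquivalence = record
                    { refl = ≈⇒∼ ≈ᴹ-refl ; sym = ∼-sym ; trans = ∼-trans }
                  ; ∙-cong = λ p q → respects (sum-diff _ _ _ _) (+-closed p q)
                  }
                ; assoc = λ x y z → ≈⇒∼ (+ᴹ-assoc x y z)
                }
              ; identity = (λ x → ≈⇒∼ (+ᴹ-identityˡ x))
                         , (λ x → ≈⇒∼ (+ᴹ-identityʳ x))
              }
            ; comm = λ x y → ≈⇒∼ (+ᴹ-comm x y)
            }
          ; isPreleftSemimodule = record
            { *ₗ-cong = λ {r} {s} r≈s p → ∼-trans
                (respects (scale-diff r _ _) (*-closed r p))
                (≈⇒∼ (*ₗ-congʳ r≈s))
            ; *ₗ-zeroˡ = λ x → ≈⇒∼ (*ₗ-zeroˡ x)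
            ; *ₗ-distribʳ = λ x r s → ≈⇒∼ (*ₗ-distribʳ x r s)
            ; *ₗ-identityˡ = λ x → ≈⇒∼ (*ₗ-identityˡ x)
            ; *ₗ-assoc = λ r s x → ≈⇒∼ (*ₗ-assoc r s x)
            ; *ₗ-zeroʳ = λ r → ≈⇒∼ (*ₗ-zeroʳ r)
            ; *ₗ-distribˡ = λ r x y → ≈⇒∼ (*ₗ-distribˡ r x y)
            }
          }
        ; -ᴹ‿cong = λ {x} {y} p →
            respects (≈ᴹ-sym (⁻¹-∙-comm x (-ᴹ y))) (neg-closed p)
        ; -ᴹ‿inverse = (λ x → ≈⇒∼ (-ᴹ‿inverseˡ x))
                     , (λ x → ≈⇒∼ (-ᴹ‿inverseʳ x))
        }
      }

  ----------------------------------------------------------------------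
  -- Presentations by generators and relations

  module _ (G : Set ℓ) where
    open Ring R using (Carrier)

    data Term : Set ℓ where
      gen : G → Term
      _⊕_ : Term → Term → Term
      𝟘   : Term
      ⊖_  : Term → Term
      _⊙_ : Carrier → Term → Term

  module _ {G I : Set ℓ} (ρ : I → Term G) where
    open Ring R using (_≈_; _+_; _*_; 1#; 0#)

    -- The least congruence containing the left module laws and the
    -- relations  ρ i = 0.
    infix 4 _≋_
    data _≋_ : Term G → Term G → Set ℓ where
      rel         : ∀ i → ρ i ≋ 𝟘
      ≋-refl      : ∀ {t} → t ≋ t
      ≋-sym       : ∀ {t u} → t ≋ u → u ≋ t
      ≋-trans     : ∀ {t u v} → t ≋ u → u ≋ v → t ≋ v
      ⊕-cong      : ∀ {t u v w} → t ≋ u → v ≋ w → (t ⊕ v) ≋ (u ⊕ w)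
      ⊖-cong      : ∀ {t u} → t ≋ u → (⊖ t) ≋ (⊖ u)
      ⊙-cong      : ∀ {r s t u} → r ≈ s → t ≋ u → (r ⊙ t) ≋ (s ⊙ u)
      ⊕-assoc     : ∀ t u v → ((t ⊕ u) ⊕ v) ≋ (t ⊕ (u ⊕ v))
      ⊕-comm      : ∀ t u → (t ⊕ u) ≋ (u ⊕ t)
      ⊕-identityˡ : ∀ t → (𝟘 ⊕ t) ≋ t
      ⊖-inverseˡ  : ∀ t → ((⊖ t) ⊕ t) ≋ 𝟘
      ⊙-zeroˡ     : ∀ t → (0# ⊙ t) ≋ 𝟘
      ⊙-zeroʳ     : ∀ r → (r ⊙ 𝟘) ≋ 𝟘
      ⊙-distribˡ  : ∀ r t u → (r ⊙ (t ⊕ u)) ≋ ((r ⊙ t) ⊕ (r ⊙ u))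
      ⊙-distribʳ  : ∀ t r s → ((r + s) ⊙ t) ≋ ((r ⊙ t) ⊕ (s ⊙ t))
      ⊙-identityˡ : ∀ t → (1# ⊙ t) ≋ t
      ⊙-assoc     : ∀ r s t → ((r * s) ⊙ t) ≋ (r ⊙ (s ⊙ t))

    presented : LeftModule R ℓ ℓ
    presented = record
      { Carrierᴹ = Term G
      ; _≈ᴹ_ = _≋_
      ; _+ᴹ_ = _⊕_
      ; _*ₗ_ = _⊙_
      ; 0ᴹ = 𝟘
      ; -ᴹ_ = ⊖_
      ; isLeftModule = record
        { isLeftSemimodule = record
          { +ᴹ-isCommutativeMonoid = record
            { isMonoid = record
              { isSemigroup = record
                { isMagma = record
                  { isEquivalence = record
                    { refl = ≋-refl ; sym = ≋-sym ; trans = ≋-trans }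
                  ; ∙-cong = ⊕-cong
                  }
                ; assoc = ⊕-assoc
                }
              ; identity = ⊕-identityˡ
                         , (λ t → ≋-trans (⊕-comm t 𝟘) (⊕-identityˡ t))
              }
            ; comm = ⊕-comm
            }
          ; isPreleftSemimodule = record
            { *ₗ-cong = ⊙-cong
            ; *ₗ-zeroˡ = ⊙-zeroˡ
            ; *ₗ-distribʳ = ⊙-distribʳ
            ; *ₗ-identityˡ = ⊙-identityˡ
            ; *ₗ-assoc = ⊙-assoc
            ; *ₗ-zeroʳ = ⊙-zeroʳ
            ; *ₗ-distribˡ = ⊙-distribˡ
            }
          }
        ; -ᴹ‿cong = ⊖-cong
        ; -ᴹ‿inverse = ⊖-inverseˡ
                     , (λ t → ≋-trans (⊕-comm t (⊖ t)) (⊖-inverseˡ t))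
        }
      }

  _IsLess_Presented : LeftModule R ℓ ℓ → Set ℓ → Set (suc ℓ)
  M IsLess κ Presented =
    ∃ λ (G : Set ℓ) → ∃ λ (I : Set ℓ) → ∃ λ (ρ : I → Term G) →
    setoid G ≺ setoid κ × setoid I ≺ setoid κ × presented ρ ≅ M

  ----------------------------------------------------------------------
  -- Ext¹, as the set of equivalence classes of extensions

  -- Short exact sequences  0 → C → E → X → 0
  record Extension (X C : LeftModule R ℓ ℓ) : Set (suc ℓ) where
    private
      module X = LeftModule X
      module C = LeftModule C
    field
      E       : LeftModule R ℓ ℓ
    open LeftModule E using (_≈ᴹ_)
    field
      ι       : C.Carrierᴹ → Carrierᴹ E
      π       : Carrierᴹ E → X.Carrierᴹ
      ι-mono  : IsMono C E ι
      π-hom   : IsHom E X π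
      π-surj  : Surjective _≈ᴹ_ X._≈ᴹ_ π
      exact   : ∀ e → (π e X.≈ᴹ X.0ᴹ) ⇔ (∃ λ c → ι c ≈ᴹ e)

  module _ {X C : LeftModule R ℓ ℓ} where

    record _≃_ (𝓔 𝓕 : Extension X C) : Set ℓ where
      private
        module 𝓔 = Extension 𝓔
        module 𝓕 = Extension 𝓕
        module X = LeftModule X
        module F = LeftModule 𝓕.E
      field
        φ      : Carrierᴹ 𝓔.E → Carrierᴹ 𝓕.E
        φ-iso  : IsIso 𝓔.E 𝓕.E φ
        φ∘ι≈ι  : ∀ c → φ (𝓔.ι c) F.≈ᴹ 𝓕.ι c
        π∘φ≈π  : ∀ e → 𝓕.π (φ e) X.≈ᴹ 𝓔.π e

  -- The extension  0 → C → C × X → X → 0,  whose class is the zero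
  -- element of Ext¹(X, C).
  splitExtension : (X C : LeftModule R ℓ ℓ) → Extension X C
  splitExtension X C = record
    { E      = leftModule C X
    ; ι      = λ c → c , X.0ᴹ
    ; π      = proj₂
    ; ι-mono = record
      { isLeftModuleHomomorphism = record
        { +ᴹ-isGroupHomomorphism = record
          { isMonoidHomomorphism = record
            { isMagmaHomomorphism = record
              { isRelHomomorphism = record { cong = λ p → p , X.≈ᴹ-refl }
              ; homo = λ _ _ → C.≈ᴹ-refl , X.≈ᴹ-sym (X.+ᴹ-identityˡ X.0ᴹ)
              }
            ; ε-homo = C.≈ᴹ-refl , X.≈ᴹ-refl
            }
          ; ⁻¹-homo = λ _ → C.≈ᴹ-refl
                          , X.≈ᴹ-sym (X.≈ᴹ-trans (X.≈ᴹ-sym (X.+ᴹ-identityʳ _))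
                                                 (X.-ᴹ‿inverseˡ X.0ᴹ))
          }
        ; *ₗ-homo = λ r _ → C.≈ᴹ-refl , X.≈ᴹ-sym (X.*ₗ-zeroʳ r)
        }
      ; injective = proj₁
      }
    ; π-hom  = record
      { +ᴹ-isGroupHomomorphism = record
        { isMonoidHomomorphism = record
          { isMagmaHomomorphism = record
            { isRelHomomorphism = record { cong = proj₂ }
            ; homo = λ _ _ → X.≈ᴹ-refl
            }
          ; ε-homo = X.≈ᴹ-refl
          }
        ; ⁻¹-homo = λ _ → X.≈ᴹ-refl
        }
      ; *ₗ-homo = λ _ _ → X.≈ᴹ-refl
      }
    ; π-surj = λ x → (C.0ᴹ , x) , proj₂
    ; exact  = λ (c , x) → record
      { to        = λ x≈0 → c , C.≈ᴹ-refl , X.≈ᴹ-sym x≈0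
      ; from      = λ (_ , _ , 0≈x) → X.≈ᴹ-sym 0≈x
      ; to-cong   = λ { _≡_.refl → _≡_.refl }
      ; from-cong = λ { _≡_.refl → _≡_.refl }
      }
    }
    where
    module X = LeftModule X
    module C = LeftModule C

  Ext¹[_,_]≈0 : LeftModule R ℓ ℓ → LeftModule R ℓ ℓ → Set (suc ℓ)
  Ext¹[ X , C ]≈0 = ∀ (𝓔 : Extension X C) → 𝓔 ≃ splitExtension X C

  ⊥[_] : Pred (LeftModule R ℓ ℓ) p → Pred (LeftModule R ℓ ℓ) (suc ℓ ⊔ p)
  ⊥[ 𝒞 ] X = ∀ C → 𝒞 C → Ext¹[ X , C ]≈0

  -- The class of members of an indexed family of modules.
  Members : {I : Set i} → (I → LeftModule R ℓ ℓ) →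
            Pred (LeftModule R ℓ ℓ) (i ⊔ suc ℓ)
  Members S M = ∃ λ j → M ≡ S j

  ----------------------------------------------------------------------
  -- Kaplansky classes

  -- κ must be required to be infinite: for κ = 0 the condition below
  -- holds vacuously for every class.
  IsKaplansky : Pred (LeftModule R ℓ ℓ) p → Set (suc ℓ ⊔ p)
  IsKaplansky 𝒞 =
    ∃ λ (κ : Set ℓ) → IsInfinite κ ×
    (∀ (C : LeftModule R ℓ ℓ) → 𝒞 C →
     let open LeftModule C using (_≈ᴹ_; ≈ᴹ-setoid) in
     ∀ (X : Pred (Carrierᴹ C) ℓ) → X Respects _≈ᴹ_ →
     On.setoid {B = Σ (Carrierᴹ C) X} ≈ᴹ-setoid proj₁ ≺ setoid κ →
     ∃ λ (C₀ : Submodule C) →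
       (submodule C₀ IsLess κ Presented) ×
       X ⊆ Submodule.Member C₀ ×
       𝒞 (submodule C₀) ×
       𝒞 (quotient C₀))

{-# OPTIONS --safe #-}
-- Let κ be supercompact and larger than R, the index set and all members S of the family, let
-- Ext(C, S) = 0, and let N x be the submodule spanned by x ∈ 𝒫<κ(C).  With respect to a normal
-- measure, almost every N x contains a given small subset and is <κ-presented.  A function
-- into S on 𝒫<κ(C) is constant almost everywhere, so data given on the submodules N x with
-- values in S come, for almost all x, from data on C: this is reflection for j : V → M in
-- terms of the measure, with j″C ⊆ j(C) represented by x ↦ N x.
-- (1) Extensions E x of N x by S combine into an extension of C by S, which splits; by
-- normality so do almost all E x.
-- (2) For extensions E x of C / N x by S, the map C → C / N x lifts to E x.  On N x the lift
-- takes values in S, so almost everywhere it is the restriction of one homomorphism C → S;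
-- subtracting that yields a splitting of E x.
module Submission where

open import Defs
open import Algebra.Bundles using (CommutativeMonoid; Ring)
open import Algebra.Module.Bundles using (LeftModule)
open import Algebra.Module.Construct.DirectProduct using (leftModule)
import Algebra.Properties.AbelianGroup as AbelianGroupProperties
import Algebra.Properties.CommutativeSemigroup as CommutativeSemigroupProperties
open import Axiom.ExcludedMiddle using (ExcludedMiddle)
open import Axiom.Extensionality.Propositional using (Extensionality)
open import Data.Bool.Base using (Bool; T)
open import Data.Bool.Properties using (T-irrelevant)
open import Data.Empty using (⊥-elim)
open import Data.Irrelevant using ([_])
open import Data.Nat.Base using (ℕ; zero; suc)
open import Data.Product.Base using (Σ; ∃; _×_; _,_; proj₁; proj₂)
open import Data.Refinement using (value; _,_)
open import Data.Sum.Base using (_⊎_; inj₁; inj₂)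
open import Data.Sum.Properties using (inj₁-injective; inj₂-injective)
open import Function.Bundles using (Injection; mk⇔; module Equivalence)
import Function.Construct.Composition as Composition
open import Level using (Level; Lift; lift; lower)
open import Relation.Binary.Bundles using (Setoid)
import Relation.Binary.Construct.On as On
open import Relation.Binary.Definitions using (_Respects_)
open import Relation.Binary.PropositionalEquality
  using (_≡_; refl; sym; trans; cong; cong₂; subst; setoid)
import Relation.Binary.Reasoning.Setoid as ≈-Reasoning
open import Relation.Nullary.Decidable
  using (yes; no; recompute; decidable-stable; toWitness; fromWitness; isYes)
open import Relation.Nullary.Negation using (¬_)
open import Relation.Unary using (Pred; _⊆_; ∁)

private
  variable
    ℓ ℓ₁ ℓ₂ ℓ₃ ℓ₄ ℓ₅ ℓ₆ : Level

-- Cardinals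

≼-trans : {A : Setoid ℓ₁ ℓ₂} {B : Setoid ℓ₃ ℓ₄} {C : Setoid ℓ₅ ℓ₆} → A ≼ B → B ≼ C → A ≼ C
≼-trans = Composition.injection

≼-≺-trans : {A : Setoid ℓ₁ ℓ₂} {B : Setoid ℓ₃ ℓ₄} {C : Setoid ℓ₅ ℓ₆} → A ≼ B → B ≺ C → A ≺ C
≼-≺-trans A≼B (B≼C , C⋠B) = ≼-trans A≼B B≼C , λ C≼A → C⋠B (≼-trans C≼A A≼B)

injective⇒≼ : {A : Set ℓ₁} {B : Set ℓ₂} (f : A → B) → (∀ {x y} → f x ≡ f y → x ≡ y) →
               setoid A ≼ setoid B
injective⇒≼ f f-inj = record { to = f ; cong = cong f ; injective = f-inj }

Lift-≼ : {A : Set ℓ₁} → setoid (Lift ℓ A) ≼ setoid A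
Lift-≼ = injective⇒≼ lower λ { refl → refl }

Σ-T-≡ : {A : Set ℓ₁} {p : A → Bool} {x y : Σ A (λ z → T (p z))} → proj₁ x ≡ proj₁ y → x ≡ y
Σ-T-≡ {x = x , _} refl = cong (x ,_) (T-irrelevant _ _)

Σ-T-≼ : {A : Set ℓ₁} {p : A → Bool} → setoid (Σ A (λ z → T (p z))) ≼ setoid A
Σ-T-≼ = injective⇒≼ proj₁ Σ-T-≡

-- Consequences of excluded middle

module Classical (em : ∀ {a} → ExcludedMiddle a) where

  -- The bound stored in a refinement is irrelevant; excluded middle decides it, so it can be
  -- recomputed.
  value-small : {κ A : Set ℓ} (x : 𝒫< κ A) → setoid (∃ λ e → T (value x e)) ≺ setoid κ
  value-small (_ , [ small ]) = recompute em small

  dne : {A : Set ℓ₁} → ¬ ¬ A → A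
  dne = decidable-stable em

  holds : Set ℓ₁ → Bool
  holds A = isYes (em {P = A})

  module _ {A : Set ℓ₁} where

    holds-sound : T (holds A) → A
    holds-sound = toWitness

    holds-complete : A → T (holds A)
    holds-complete = fromWitness

  -- Arguments almost everywhere for a normal measure

  module AlmostAll {κ A : Set ℓ} (uncountable : IsUncountable κ) (μ : NormalMeasure κ A) where
    open NormalMeasure μ

    P = 𝒫< κ A

    always : {X : Pred P ℓ} → (∀ x → X x) → U X
    always {X} all with ultra X
    ... | inj₁ u = u
    ... | inj₂ u = ⊥-elim (proper (upward (λ {x} ¬Xx → ⊥-elim (¬Xx (all x))) u))

    satisfiable : {X : Pred P ℓ} → U X → ∃ X
    satisfiable u = dne λ ∄ → proper (upward (λ {x} Xx → ⊥-elim (∄ (x , Xx))) u)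

    -- Completeness is applied to the sequence X, Y, Y, ..., which may be countable because κ is
    -- uncountable.
    both : {X Y : Pred P ℓ} → U X → U Y → U (λ x → X x × Y x)
    both {X} {Y} uX uY =
      upward (λ all → all (lift zero) , all (lift 1))
        (complete (Lift ℓ ℕ) (≼-≺-trans Lift-≼ uncountable) XY U-XY)
      where
      XY : Lift ℓ ℕ → Pred P ℓ
      XY (lift zero)    = X
      XY (lift (suc _)) = Y

      U-XY : ∀ n → U (XY n)
      U-XY (lift zero)    = uX
      U-XY (lift (suc _)) = uY

    zip : {X Y Z : Pred P ℓ} → (∀ x → X x → Y x → Z x) → U X → U Y → U Z
    zip f uX uY = upward (λ {x} (Xx , Yx) → f x Xx Yx) (both uX uY)

    not-U : {X : Pred P ℓ} → ¬ U X → U (∁ X)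
    not-U {X} ¬u with ultra X
    ... | inj₁ u = ⊥-elim (¬u u)
    ... | inj₂ u = u

    -- If every fibre were null, the fewer than κ complements would share a point x, and `F` would
    -- miss its own value `F x` there.
    constant : {D : Set ℓ} → setoid D ≺ setoid κ → (F : P → D) → ∃ λ d → U (λ x → F x ≡ d)
    constant D≺κ F = dne λ ∄ →
      let x , F≢ = satisfiable (complete _ D≺κ _ (λ d → not-U (λ u → ∄ (d , u))))
      in F≢ (F x) refl

    -- Normality makes `F` constant almost everywhere, so only one of the sets `X a` is needed.
    regressive : (F : P → A) (X : A → Pred P ℓ) → U (λ x → Lift ℓ (T (value x (F x)))) →
                 (∀ a → U (X a)) → U (λ x → X (F x) x)
    regressive F X F∈ uX = let a , F≡a = normal F F∈ in
      zip (λ x F≡a → subst (λ b → X b x) (sym F≡a)) F≡a (uX a)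

    -- If this diagonal intersection were null, a counterexample in x could be chosen for almost all
    -- x. The choice is a regressive function, so `regressive` yields `X` at the counterexample
    -- itself.
    diagonal : (X : A → Pred P ℓ) → (∀ a → U (X a)) → U (λ x → ∀ a → T (value x a) → X a x)
    diagonal X uX = dne λ ¬u → impossible (not-U ¬u)
      where
      Fails : P → A → Set ℓ
      Fails x a = T (value x a) × ¬ X a x

      counterexample : ∀ {x} → ¬ (∀ a → T (value x a) → X a x) → ∃ (Fails x)
      counterexample ¬all = dne λ ∄ → ¬all λ a a∈x → dne λ ¬Xax → ∄ (a , a∈x , ¬Xax)

      impossible : ¬ U (λ x → ¬ (∀ a → T (value x a) → X a x))
      impossible u =
        let x , (_ , ¬X) , Xx = satisfiable (both fails
              (regressive (λ x → proj₁ (pick x)) X (upward (λ p → lift (proj₁ p)) fails) uX))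
        in ¬X Xx
        where
        -- `pick` has to be total; this element serves where nothing fails, which is a null set of
        -- x.
        default : A
        default = proj₁ (counterexample (proj₂ (satisfiable u)))

        pick : ∀ x → ∃ λ a → ∃ (Fails x) → Fails x a
        pick x with em {P = ∃ (Fails x)}
        ... | yes (a , p) = a , λ _ → p
        ... | no ∄       = default , λ ∃f → ⊥-elim (∄ ∃f)

        fails : U (λ x → Fails x (proj₁ (pick x)))
        fails = upward (λ {x} ¬all → proj₂ (pick x) (counterexample ¬all)) u

    -- Quantification over a setoid is reduced to one over its image in κ, which is a set.
    complete-setoid : (D : Setoid ℓ ℓ₁) → D ≺ setoid κ → let open Setoid D in
                      (X : Carrier → Pred P ℓ) → (∀ {d e} → d ≈ e → X d ⊆ X e) →
                      (∀ d → U (X d)) → U (λ x → ∀ d → X d x)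
    complete-setoid D (D≼κ , κ⋠D) X X-resp uX =
      upward (λ all d → let k∈ = holds-complete (d , refl) in
                X-resp (f.injective (proj₂ (preimage (f.to d , k∈)))) (all (f.to d , k∈)))
        (complete Image (Σ-T-≼ , λ κ≼Image → κ⋠D (≼-trans κ≼Image Image≼D))
          (λ i → X (proj₁ (preimage i))) (λ i → uX _))
      where
      module D = Setoid D
      module f = Injection D≼κ

      Image : Set ℓ
      Image = ∃ λ k → T (holds (∃ λ d → f.to d ≡ k))

      preimage : ((k , _) : Image) → ∃ λ d → f.to d ≡ k
      preimage (_ , k∈) = holds-sound k∈

      Image≼D : setoid Image ≼ D
      Image≼D = record
        { to        = λ i → proj₁ (preimage i)
        ; cong      = λ { refl → D.refl }
        ; injective = λ {i} {j} d≈e → Σ-T-≡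
            (trans (sym (proj₂ (preimage i))) (trans (f.cong d≈e) (proj₂ (preimage j))))
        }

  -- Cardinal arithmetic below a supercompact cardinal

  module _ {κ : Set ℓ} (κ-supercompact : IsSupercompact κ) where

    private
      uncountable = proj₁ κ-supercompact

    -- If every D-valued function is constant almost everywhere, then D ⊆ x for almost all
    -- x ∈ 𝒫< κ (κ ⊎ D), and every x is smaller than κ.
    constant⇒≺ : (D : Set ℓ) →
                 (∀ (μ : NormalMeasure κ (κ ⊎ D)) (F : 𝒫< κ (κ ⊎ D) → D) →
                    ∃ λ d → NormalMeasure.U μ (λ x → F x ≡ d)) →
                 setoid D ≺ setoid κ
    constant⇒≺ D const = ≼-≺-trans D≼x (value-small (proj₁ covering))
      where
      μ = proj₂ κ-supercompact (κ ⊎ D) (injective⇒≼ inj₁ inj₁-injective)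
      open NormalMeasure μ
      open AlmostAll uncountable μ

      Covers : Pred P ℓ
      Covers x = Lift ℓ (∀ d → T (value x (inj₂ d)))

      missing : ∀ x → ¬ Covers x → ∃ λ d → ¬ T (value x (inj₂ d))
      missing x ¬covers = dne λ ∄ → ¬covers (lift λ d → dne λ d∉x → ∄ (d , d∉x))

      covering : ∃ Covers
      covering = satisfiable (dne λ ¬u → impossible (not-U ¬u))
        where
        impossible : ¬ U (∁ Covers)
        impossible u =
          -- A single d is left out by almost every x, whereas fineness puts `inj₂ d` into almost
          -- every x.
          let d , F≡d = const μ (λ x → proj₁ (F x))
              x , (F≡d , ¬covers) , lift d∈x = satisfiable (both (both F≡d u) (fine (inj₂ d)))
          in proj₂ (F x) ¬covers (subst (λ e → T (value x (inj₂ e))) (sym F≡d) d∈x)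
          where
          F : ∀ x → ∃ λ d → ¬ Covers x → ¬ T (value x (inj₂ d))
          F x with em {P = Covers x}
          ... | no ¬covers  = let d , d∉x = missing x ¬covers in d , λ _ → d∉x
          ... | yes covers  =
            -- Any element of D will do here; a point of the measure-one set given by u supplies
            -- one.
            proj₁ (missing (proj₁ (satisfiable u)) (proj₂ (satisfiable u))) ,
            λ ¬covers → ⊥-elim (¬covers covers)

      D≼x : setoid D ≼ setoid (∃ λ e → T (value (proj₁ covering) e))
      D≼x = injective⇒≼ (λ d → inj₂ d , lower (proj₂ covering) d)
                        (λ eq → inj₂-injective (cong proj₁ eq))

    -- If all fibres were null, completeness over D and over E would give a point x whose value lies
    -- in neither summand.
    ⊎-≺ : {D E : Set ℓ} → setoid D ≺ setoid κ → setoid E ≺ setoid κ → setoid (D ⊎ E) ≺ setoid κ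
    ⊎-≺ {D} {E} D≺κ E≺κ = constant⇒≺ (D ⊎ E) λ μ F →
      let open NormalMeasure μ
          open AlmostAll uncountable μ
      in dne λ ∄ →
      let x , ≢inj₁ , ≢inj₂ = satisfiable (both
            (complete D D≺κ _ (λ d → not-U (λ u → ∄ (inj₁ d , u))))
            (complete E E≺κ _ (λ e → not-U (λ u → ∄ (inj₂ e , u)))))
      in absurd (F x) ≢inj₁ ≢inj₂
      where
      absurd : (z : D ⊎ E) → (∀ d → ¬ z ≡ inj₁ d) → ¬ (∀ e → ¬ z ≡ inj₂ e)
      absurd (inj₁ d) ≢inj₁ ≢inj₂ = ≢inj₁ d refl
      absurd (inj₂ e) ≢inj₁ ≢inj₂ = ≢inj₂ e refl

    ×-≺ : {D E : Set ℓ} → setoid D ≺ setoid κ → setoid E ≺ setoid κ → setoid (D × E) ≺ setoid κ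
    ×-≺ {D} {E} D≺κ E≺κ = constant⇒≺ (D × E) λ μ F →
      let open AlmostAll uncountable μ
          d , F₁≡d = constant D≺κ (λ x → proj₁ (F x))
          e , F₂≡e = constant E≺κ (λ x → proj₂ (F x))
      in (d , e) , zip (λ x → cong₂ _,_) F₁≡d F₂≡e

  -- Two equivalent elements have propositionally equal equivalence classes, as Boolean-valued
  -- predicates, and a representative is chosen from the class.
  module Representatives (ext : ∀ {a b} → Extensionality a b) (S : Setoid ℓ₁ ℓ₂) where
    open Setoid S using (Carrier; _≈_) renaming (refl to ≈-refl; sym to ≈-sym; trans to ≈-trans)

    private
      class : Carrier → Carrier → Bool
      class x y = holds (x ≈ y)

      -- The witness w only rules out the empty case, so the chosen element depends on p alone.
      choose : (p : Carrier → Bool) → ∃ (λ y → T (p y)) → ∃ (λ y → T (p y))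
      choose p w with em {P = ∃ (λ y → T (p y))}
      ... | yes y = y
      ... | no ∄  = ⊥-elim (∄ w)

      choose-cong : ∀ {p q} v w → p ≡ q → proj₁ (choose p v) ≡ proj₁ (choose q w)
      choose-cong {p} v w refl with em {P = ∃ (λ y → T (p y))}
      ... | yes _ = refl
      ... | no ∄  = ⊥-elim (∄ w)

      holds-cong : {X : Set ℓ₃} {Y : Set ℓ₄} → (X → Y) → (Y → X) → holds X ≡ holds Y
      holds-cong {X = X} {Y} f g with em {P = X} | em {P = Y}
      ... | yes _ | yes _ = refl
      ... | yes x | no ¬y = ⊥-elim (¬y (f x))
      ... | no ¬x | yes y = ⊥-elim (¬x (g y))
      ... | no _  | no _  = refl

      chosen : ∀ x → ∃ λ y → T (class x y)
      chosen x = choose (class x) (x , holds-complete ≈-refl)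

    rep : Carrier → Carrier
    rep x = proj₁ (chosen x)

    rep-≈ : ∀ x → rep x ≈ x
    rep-≈ x = ≈-sym (holds-sound (proj₂ (chosen x)))

    rep-cong : ∀ {x y} → x ≈ y → rep x ≡ rep y
    rep-cong x≈y = choose-cong _ _
      (ext λ z → holds-cong (≈-trans (≈-sym x≈y)) (≈-trans x≈y))

-- Homomorphisms and extensions

module _ {ℓ} {R : Ring ℓ ℓ} where

  open LeftModule using (Carrierᴹ)

  private
    Mod = LeftModule R ℓ ℓ

  module ModuleLemmas (M : Mod) where
    open LeftModule M public
    open AbelianGroupProperties +ᴹ-abelianGroup public
      using (⁻¹-∙-comm; ε⁻¹≈ε; inverseˡ-unique; inverseʳ-unique; identityˡ-unique; ∙-cancelʳ)
    open CommutativeSemigroupProperties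
      (CommutativeMonoid.commutativeSemigroup +ᴹ-commutativeMonoid) public
      using (interchange)
    module R = Ring R
    open ≈-Reasoning ≈ᴹ-setoid

    x-y+y≈x : ∀ x y → (x +ᴹ -ᴹ y) +ᴹ y ≈ᴹ x
    x-y+y≈x x y = begin
      (x +ᴹ -ᴹ y) +ᴹ y   ≈⟨ +ᴹ-assoc x (-ᴹ y) y ⟩
      x +ᴹ (-ᴹ y +ᴹ y)   ≈⟨ +ᴹ-congˡ (-ᴹ‿inverseˡ y) ⟩
      x +ᴹ 0ᴹ            ≈⟨ +ᴹ-identityʳ x ⟩
      x                  ∎

    x-y≈0⇒x≈y : ∀ {x y} → x +ᴹ -ᴹ y ≈ᴹ 0ᴹ → x ≈ᴹ y
    x-y≈0⇒x≈y {x} {y} eq = begin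
      x                  ≈⟨ x-y+y≈x x y ⟨
      (x +ᴹ -ᴹ y) +ᴹ y   ≈⟨ +ᴹ-congʳ eq ⟩
      0ᴹ +ᴹ y            ≈⟨ +ᴹ-identityˡ y ⟩
      y                  ∎

    x≈y⇒x-y≈0 : ∀ {x y} → x ≈ᴹ y → x +ᴹ -ᴹ y ≈ᴹ 0ᴹ
    x≈y⇒x-y≈0 {y = y} eq = ≈ᴹ-trans (+ᴹ-congʳ eq) (-ᴹ‿inverseʳ y)

    -1*x≈-x : ∀ x → (R.- R.1#) *ₗ x ≈ᴹ -ᴹ x
    -1*x≈-x x = inverseˡ-unique _ x (begin
      (R.- R.1#) *ₗ x +ᴹ x             ≈⟨ +ᴹ-congˡ (*ₗ-identityˡ x) ⟨
      (R.- R.1#) *ₗ x +ᴹ R.1# *ₗ x     ≈⟨ *ₗ-distribʳ x (R.- R.1#) R.1# ⟨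
      ((R.- R.1#) R.+ R.1#) *ₗ x       ≈⟨ *ₗ-congʳ (R.-‿inverseˡ R.1#) ⟩
      R.0# *ₗ x                        ≈⟨ *ₗ-zeroˡ x ⟩
      0ᴹ                               ∎)

    *ₗ-neg : ∀ r x → r *ₗ (-ᴹ x) ≈ᴹ -ᴹ (r *ₗ x)
    *ₗ-neg r x = inverseʳ-unique (r *ₗ x) (r *ₗ (-ᴹ x)) (begin
      r *ₗ x +ᴹ r *ₗ (-ᴹ x)   ≈⟨ *ₗ-distribˡ r x (-ᴹ x) ⟨
      r *ₗ (x +ᴹ -ᴹ x)        ≈⟨ *ₗ-congˡ (-ᴹ‿inverseʳ x) ⟩
      r *ₗ 0ᴹ                 ≈⟨ *ₗ-zeroʳ r ⟩
      0ᴹ                      ∎)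

  module Hom (M N : Mod) {f : Carrierᴹ M → Carrierᴹ N} (f-hom : IsHom M N f) =
    IsHom M N f-hom

  module _ (M N : Mod) where
    private
      module M = ModuleLemmas M
      module N = ModuleLemmas N
    open ≈-Reasoning N.≈ᴹ-setoid

    mkHom : (f : Carrierᴹ M → Carrierᴹ N) →
            (∀ {x y} → x M.≈ᴹ y → f x N.≈ᴹ f y) →
            (∀ x y → f (x M.+ᴹ y) N.≈ᴹ f x N.+ᴹ f y) →
            (∀ r x → f (r M.*ₗ x) N.≈ᴹ r N.*ₗ f x) →
            IsHom M N f
    mkHom f f-cong f-+ f-* = record
      { +ᴹ-isGroupHomomorphism = record
        { isMonoidHomomorphism = record
          { isMagmaHomomorphism = record
            { isRelHomomorphism = record { cong = f-cong }
            ; homo = f-+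
            }
          ; ε-homo = f-0
          }
        ; ⁻¹-homo = λ x → N.inverseˡ-unique (f (M.-ᴹ x)) (f x) (begin
            f (M.-ᴹ x) N.+ᴹ f x    ≈⟨ f-+ (M.-ᴹ x) x ⟨
            f (M.-ᴹ x M.+ᴹ x)      ≈⟨ f-cong (M.-ᴹ‿inverseˡ x) ⟩
            f M.0ᴹ                 ≈⟨ f-0 ⟩
            N.0ᴹ                   ∎)
        }
      ; *ₗ-homo = f-*
      }
      where
      f-0 : f M.0ᴹ N.≈ᴹ N.0ᴹ
      f-0 = N.identityˡ-unique (f M.0ᴹ) (f M.0ᴹ) (begin
        f M.0ᴹ N.+ᴹ f M.0ᴹ   ≈⟨ f-+ M.0ᴹ M.0ᴹ ⟨
        f (M.0ᴹ M.+ᴹ M.0ᴹ)   ≈⟨ f-cong (M.+ᴹ-identityˡ M.0ᴹ) ⟩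
        f M.0ᴹ               ∎)

    mkIso : (f : Carrierᴹ M → Carrierᴹ N) → IsHom M N f →
            (∀ {x y} → f x N.≈ᴹ f y → x M.≈ᴹ y) →
            (∀ y → ∃ λ x → f x N.≈ᴹ y) →
            IsIso M N f
    mkIso f f-hom f-inj f-surj = record
      { isLeftModuleMonomorphism = record
        { isLeftModuleHomomorphism = f-hom
        ; injective = f-inj
        }
      ; surjective = λ y → let x , fx≈y = f-surj y in
          x , λ z≈x → N.≈ᴹ-trans (Hom.⟦⟧-cong M N f-hom z≈x) fx≈y
      }

    difference-hom : ∀ {f g : Carrierᴹ M → Carrierᴹ N} → IsHom M N f → IsHom M N g →
                     IsHom M N (λ x → f x N.+ᴹ N.-ᴹ g x)
    difference-hom {f} {g} f-hom g-hom = mkHom _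
      (λ x≈y → N.+ᴹ-cong (F.⟦⟧-cong x≈y) (N.-ᴹ‿cong (G.⟦⟧-cong x≈y)))
      (λ x y → begin
        f (x M.+ᴹ y) N.+ᴹ N.-ᴹ g (x M.+ᴹ y)
          ≈⟨ N.+ᴹ-cong (F.+ᴹ-homo x y) (N.-ᴹ‿cong (G.+ᴹ-homo x y)) ⟩
        (f x N.+ᴹ f y) N.+ᴹ N.-ᴹ (g x N.+ᴹ g y)
          ≈⟨ N.+ᴹ-congˡ (N.⁻¹-∙-comm (g x) (g y)) ⟨
        (f x N.+ᴹ f y) N.+ᴹ (N.-ᴹ g x N.+ᴹ N.-ᴹ g y)
          ≈⟨ N.interchange (f x) (f y) (N.-ᴹ g x) (N.-ᴹ g y) ⟩
        (f x N.+ᴹ N.-ᴹ g x) N.+ᴹ (f y N.+ᴹ N.-ᴹ g y) ∎)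
      (λ r x → begin
        f (r M.*ₗ x) N.+ᴹ N.-ᴹ g (r M.*ₗ x)
          ≈⟨ N.+ᴹ-cong (F.*ₗ-homo r x) (N.-ᴹ‿cong (G.*ₗ-homo r x)) ⟩
        r N.*ₗ f x N.+ᴹ N.-ᴹ (r N.*ₗ g x)
          ≈⟨ N.+ᴹ-congˡ (N.*ₗ-neg r (g x)) ⟨
        r N.*ₗ f x N.+ᴹ r N.*ₗ (N.-ᴹ g x)
          ≈⟨ N.*ₗ-distribˡ r (f x) (N.-ᴹ g x) ⟨
        r N.*ₗ (f x N.+ᴹ N.-ᴹ g x) ∎)
      where
      module F = Hom M N f-hom
      module G = Hom M N g-hom

  quotient-hom : ∀ {M N : Mod} (P : Submodule M) {f} → IsHom M N f →
                 let open LeftModule N in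
                 (∀ x → Submodule.Member P x → f x ≈ᴹ 0ᴹ) →
                 IsHom (quotient P) N f
  quotient-hom {M} {N} P {f} f-hom f≈0 = mkHom (quotient P) N f
    (λ {x} {y} x-y∈P → N.x-y≈0⇒x≈y (begin
      f x N.+ᴹ N.-ᴹ f y      ≈⟨ N.+ᴹ-congˡ (F.-ᴹ-homo y) ⟨
      f x N.+ᴹ f (M.-ᴹ y)    ≈⟨ F.+ᴹ-homo x (M.-ᴹ y) ⟨
      f (x M.+ᴹ M.-ᴹ y)      ≈⟨ f≈0 _ x-y∈P ⟩
      N.0ᴹ                   ∎))
    F.+ᴹ-homo F.*ₗ-homo
    where
    module M = ModuleLemmas M
    module N = ModuleLemmas N
    module F = Hom M N f-hom
    open ≈-Reasoning N.≈ᴹ-setoid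

  -- Splittings of extensions

  module Ext {X C : Mod} (𝓔 : Extension X C) where
    open Extension 𝓔 public
    module X = ModuleLemmas X
    module C = ModuleLemmas C
    module E = ModuleLemmas E
    module ι = IsMono C E ι-mono
    module π = Hom E X π-hom

    π∘ι≈0 : ∀ c → π (ι c) X.≈ᴹ X.0ᴹ
    π∘ι≈0 c = Equivalence.from (exact (ι c)) (c , E.≈ᴹ-refl)

  -- The form in which splitting is reflected: a section lives at level ℓ, so `U` can measure where
  -- one exists.
  record Section {X C : Mod} (𝓔 : Extension X C) : Set ℓ where
    open Ext 𝓔
    field
      σ      : Carrierᴹ X → Carrierᴹ E
      σ-hom  : IsHom X E σ
      π∘σ≈id : ∀ x → π (σ x) X.≈ᴹ x

  module _ {X C : Mod} {𝓔 : Extension X C} where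
    open Ext 𝓔

    -- Every element of E has exactly one form `ι c E.+ᴹ σ x`. The map φ reads off c and x, and its
    -- homomorphism laws follow from uniqueness.
    Section⇒split : Section 𝓔 → 𝓔 ≃ splitExtension X C
    Section⇒split record { σ = σ ; σ-hom = σ-hom ; π∘σ≈id = π∘σ≈id } = record
      { φ     = φ
      ; φ-iso = mkIso E (leftModule C X) φ
          (mkHom E (leftModule C X) φ
            (λ {e} {e′} e≈e′ → unique
              (E.≈ᴹ-trans (E.≈ᴹ-sym (split e)) (E.≈ᴹ-trans e≈e′ (split e′))))
            (λ e e′ → unique (begin
              combine (φ (e E.+ᴹ e′))              ≈⟨ split (e E.+ᴹ e′) ⟨
              e E.+ᴹ e′                            ≈⟨ E.+ᴹ-cong (split e) (split e′) ⟩
              combine (φ e) E.+ᴹ combine (φ e′)    ≈⟨ E.interchange _ _ _ _ ⟩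
              _ E.+ᴹ _                             ≈⟨ E.+ᴹ-cong (ι.+ᴹ-homo _ _) (σ.+ᴹ-homo _ _) ⟨
              ι (c e C.+ᴹ c e′) E.+ᴹ σ (π e X.+ᴹ π e′) ∎))
            (λ r e → unique (begin
              combine (φ (r E.*ₗ e))                   ≈⟨ split (r E.*ₗ e) ⟨
              r E.*ₗ e                                 ≈⟨ E.*ₗ-congˡ (split e) ⟩
              r E.*ₗ combine (φ e)                     ≈⟨ E.*ₗ-distribˡ r _ _ ⟩
              r E.*ₗ ι (c e) E.+ᴹ r E.*ₗ σ (π e)       ≈⟨ E.+ᴹ-cong (ι.*ₗ-homo r _) (σ.*ₗ-homo r _) ⟨
              ι (r C.*ₗ c e) E.+ᴹ σ (r X.*ₗ π e)       ∎)))
          (λ {e} {e′} (c≈c′ , x≈x′) → begin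
            e              ≈⟨ split e ⟩
            combine (φ e)  ≈⟨ E.+ᴹ-cong (ι.⟦⟧-cong c≈c′) (σ.⟦⟧-cong x≈x′) ⟩
            combine (φ e′) ≈⟨ split e′ ⟨
            e′             ∎)
          (λ cx → combine cx , unique (E.≈ᴹ-sym (split (combine cx))))
      ; φ∘ι≈ι = λ c → unique (begin
          combine (φ (ι c))    ≈⟨ split (ι c) ⟨
          ι c                  ≈⟨ E.+ᴹ-identityʳ (ι c) ⟨
          ι c E.+ᴹ E.0ᴹ        ≈⟨ E.+ᴹ-congˡ σ.0ᴹ-homo ⟨
          combine (c , X.0ᴹ)   ∎)
      ; π∘φ≈π = λ _ → X.≈ᴹ-refl
      }
      where
      open ≈-Reasoning E.≈ᴹ-setoid
      module σ = Hom X E σ-hom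

      combine : Carrierᴹ C × Carrierᴹ X → Carrierᴹ E
      combine (c , x) = ι c E.+ᴹ σ x

      π-combine : ∀ cx → π (combine cx) X.≈ᴹ proj₂ cx
      π-combine (c , x) =
        X.≈ᴹ-trans (π.+ᴹ-homo _ _)
          (X.≈ᴹ-trans (X.+ᴹ-cong (π∘ι≈0 c) (π∘σ≈id x)) (X.+ᴹ-identityˡ x))

      unique : ∀ {c c′ x x′} → combine (c , x) E.≈ᴹ combine (c′ , x′) →
               c C.≈ᴹ c′ × x X.≈ᴹ x′
      unique {c} {c′} {x} {x′} eq = c≈c′ , x≈x′
        where
        x≈x′ = X.≈ᴹ-trans (X.≈ᴹ-sym (π-combine _)) (X.≈ᴹ-trans (π.⟦⟧-cong eq) (π-combine _))
        c≈c′ = ι.injective (E.∙-cancelʳ (σ x) (ι c) (ι c′)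
          (E.≈ᴹ-trans eq (E.+ᴹ-congˡ (σ.⟦⟧-cong (X.≈ᴹ-sym x≈x′)))))

      -- Since σ is a section, π kills this difference, and exactness supplies the component in C.
      kernel-part : ∀ e → ∃ λ c → ι c E.≈ᴹ e E.+ᴹ E.-ᴹ σ (π e)
      kernel-part e = Equivalence.to (exact _)
        (X.≈ᴹ-trans (π.+ᴹ-homo _ _)
          (X.≈ᴹ-trans (X.+ᴹ-congˡ (π.-ᴹ-homo _))
            (X.x≈y⇒x-y≈0 (X.≈ᴹ-sym (π∘σ≈id (π e))))))

      c : Carrierᴹ E → Carrierᴹ C
      c e = proj₁ (kernel-part e)

      φ : Carrierᴹ E → Carrierᴹ C × Carrierᴹ X
      φ e = c e , π e

      split : ∀ e → e E.≈ᴹ combine (φ e)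
      split e = E.≈ᴹ-sym (E.≈ᴹ-trans (E.+ᴹ-congʳ (proj₂ (kernel-part e))) (E.x-y+y≈x _ _))

    -- Take for `σ x` the preimage of (0, x) under φ; its laws are checked after applying φ, which
    -- is injective.
    split⇒Section : 𝓔 ≃ splitExtension X C → Section 𝓔
    split⇒Section record { φ = φ ; φ-iso = φ-iso ; π∘φ≈π = π∘φ≈π } = record
      { σ      = σ
      ; σ-hom  = mkHom X E σ
          (λ x≈y → φ.injective (S.≈ᴹ-trans (φσ _) (S.≈ᴹ-trans (C.≈ᴹ-refl , x≈y) (S.≈ᴹ-sym (φσ _)))))
          (λ x y → φ.injective (S.≈ᴹ-trans (φσ _)
            (S.≈ᴹ-sym (S.≈ᴹ-trans (φ.+ᴹ-homo _ _) (S.≈ᴹ-trans (S.+ᴹ-cong (φσ x) (φσ y))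
              (C.+ᴹ-identityˡ C.0ᴹ , X.≈ᴹ-refl))))))
          (λ r x → φ.injective (S.≈ᴹ-trans (φσ _)
            (S.≈ᴹ-sym (S.≈ᴹ-trans (φ.*ₗ-homo _ _) (S.≈ᴹ-trans (S.*ₗ-congˡ (φσ x))
              (C.*ₗ-zeroʳ r , X.≈ᴹ-refl))))))
      ; π∘σ≈id = λ x → X.≈ᴹ-trans (X.≈ᴹ-sym (π∘φ≈π (σ x))) (proj₂ (φσ x))
      }
      where
      module S = LeftModule (leftModule C X)
      module φ = IsIso E (leftModule C X) φ-iso

      σ : Carrierᴹ X → Carrierᴹ E
      σ x = proj₁ (φ.surjective (C.0ᴹ , x))

      φσ : ∀ x → φ (σ x) S.≈ᴹ (C.0ᴹ , x)
      φσ x = proj₂ (φ.surjective (C.0ᴹ , x)) E.≈ᴹ-refl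

  -- The pullback of an extension of X along Y → X splits, and a section of it is a lift of
  -- Y → X.
  lift-hom : ∀ {X Y C : Mod} → Ext¹[ Y , C ]≈0 → (𝓔 : Extension X C) →
             let open Extension 𝓔 in
             ∀ {f} → IsHom Y X f →
             ∃ λ g → IsHom Y E g × (∀ y → LeftModule._≈ᴹ_ X (π (g y)) (f y))
  lift-hom {X} {Y} {C} Ext≈0 𝓔 {f} f-hom =
    (λ y → proj₁ (proj₁ (s.σ y))) ,
    mkHom Y E _ (λ y≈z → proj₁ (σ.⟦⟧-cong y≈z)) (λ y z → proj₁ (σ.+ᴹ-homo y z))
                (λ r y → proj₁ (σ.*ₗ-homo r y)) ,
    (λ y → X.≈ᴹ-trans (proj₂ (s.σ y)) (f.⟦⟧-cong (s.π∘σ≈id y)))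
    where
    open Ext 𝓔
    module Y = ModuleLemmas Y
    module f = Hom Y X f-hom

    compatible : Submodule (leftModule E Y)
    compatible = record
      { Member     = λ (e , y) → π e X.≈ᴹ f y
      ; respects   = λ (e≈e′ , y≈y′) πe≈fy →
          X.≈ᴹ-trans (π.⟦⟧-cong (E.≈ᴹ-sym e≈e′)) (X.≈ᴹ-trans πe≈fy (f.⟦⟧-cong y≈y′))
      ; 0-closed   = X.≈ᴹ-trans π.0ᴹ-homo (X.≈ᴹ-sym f.0ᴹ-homo)
      ; +-closed   = λ p q →
          X.≈ᴹ-trans (π.+ᴹ-homo _ _) (X.≈ᴹ-trans (X.+ᴹ-cong p q) (X.≈ᴹ-sym (f.+ᴹ-homo _ _)))
      ; neg-closed = λ p →
          X.≈ᴹ-trans (π.-ᴹ-homo _) (X.≈ᴹ-trans (X.-ᴹ‿cong p) (X.≈ᴹ-sym (f.-ᴹ-homo _)))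
      ; *-closed   = λ r p →
          X.≈ᴹ-trans (π.*ₗ-homo r _) (X.≈ᴹ-trans (X.*ₗ-congˡ p) (X.≈ᴹ-sym (f.*ₗ-homo r _)))
      }

    pullback : Extension Y C
    pullback = record
      { E      = submodule compatible
      ; ι      = λ c → (ι c , Y.0ᴹ) , X.≈ᴹ-trans (π∘ι≈0 c) (X.≈ᴹ-sym f.0ᴹ-homo)
      ; π      = λ ((_ , y) , _) → y
      ; ι-mono = record
        { isLeftModuleHomomorphism = mkHom C (submodule compatible) _
            (λ c≈d → ι.⟦⟧-cong c≈d , Y.≈ᴹ-refl)
            (λ c d → ι.+ᴹ-homo c d , Y.≈ᴹ-sym (Y.+ᴹ-identityˡ Y.0ᴹ))
            (λ r c → ι.*ₗ-homo r c , Y.≈ᴹ-sym (Y.*ₗ-zeroʳ r))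
        ; injective = λ (c≈d , _) → ι.injective c≈d
        }
      ; π-hom  = mkHom (submodule compatible) Y _ proj₂ (λ _ _ → Y.≈ᴹ-refl) (λ _ _ → Y.≈ᴹ-refl)
      ; π-surj = λ y → let e , πe≈ = π-surj (f y) in ((e , y) , πe≈ E.≈ᴹ-refl) , proj₂
      ; exact  = λ ((e , y) , πe≈fy) → mk⇔
          (λ y≈0 → let c , ιc≈e = Equivalence.to (exact e)
                                    (X.≈ᴹ-trans πe≈fy (X.≈ᴹ-trans (f.⟦⟧-cong y≈0) f.0ᴹ-homo))
                   in c , ιc≈e , Y.≈ᴹ-sym y≈0)
          (λ (_ , _ , 0≈y) → Y.≈ᴹ-sym 0≈y)
      }

    module s = Section (split⇒Section (Ext≈0 pullback))
    module σ = Hom Y (submodule compatible) s.σ-hom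

-- Spans and presentations

module Span {ℓ} {R : Ring ℓ ℓ} (C : LeftModule R ℓ ℓ)
            {G : Set ℓ} (v : G → LeftModule.Carrierᴹ C) where
  open ModuleLemmas C

  eval : Term {R = R} G → Carrierᴹ
  eval (gen g) = v g
  eval (t ⊕ u) = eval t +ᴹ eval u
  eval 𝟘       = 0ᴹ
  eval (⊖ t)   = -ᴹ eval t
  eval (r ⊙ t) = r *ₗ eval t

  eval-cong : {I : Set ℓ} {ρ : I → Term {R = R} G} → (∀ i → eval (ρ i) ≈ᴹ 0ᴹ) →
              ∀ {t u} → _≋_ ρ t u → eval t ≈ᴹ eval u
  eval-cong ρ≈0 (rel i)              = ρ≈0 i
  eval-cong ρ≈0 ≋-refl               = ≈ᴹ-refl
  eval-cong ρ≈0 (≋-sym p)            = ≈ᴹ-sym (eval-cong ρ≈0 p)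
  eval-cong ρ≈0 (≋-trans p q)        = ≈ᴹ-trans (eval-cong ρ≈0 p) (eval-cong ρ≈0 q)
  eval-cong ρ≈0 (⊕-cong p q)         = +ᴹ-cong (eval-cong ρ≈0 p) (eval-cong ρ≈0 q)
  eval-cong ρ≈0 (⊖-cong p)           = -ᴹ‿cong (eval-cong ρ≈0 p)
  eval-cong ρ≈0 (⊙-cong r≈s p)       = *ₗ-cong r≈s (eval-cong ρ≈0 p)
  eval-cong ρ≈0 (⊕-assoc t u w)      = +ᴹ-assoc _ _ _
  eval-cong ρ≈0 (⊕-comm t u)         = +ᴹ-comm _ _
  eval-cong ρ≈0 (⊕-identityˡ t)      = +ᴹ-identityˡ _
  eval-cong ρ≈0 (⊖-inverseˡ t)       = -ᴹ‿inverseˡ _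
  eval-cong ρ≈0 (⊙-zeroˡ t)          = *ₗ-zeroˡ _
  eval-cong ρ≈0 (⊙-zeroʳ r)          = *ₗ-zeroʳ r
  eval-cong ρ≈0 (⊙-distribˡ r t u)   = *ₗ-distribˡ r _ _
  eval-cong ρ≈0 (⊙-distribʳ t r s)   = *ₗ-distribʳ _ r s
  eval-cong ρ≈0 (⊙-identityˡ t)      = *ₗ-identityˡ _
  eval-cong ρ≈0 (⊙-assoc r s t)      = *ₗ-assoc r s _

  span : Submodule C
  span = record
    { Member     = λ c → ∃ λ t → eval t ≈ᴹ c
    ; respects   = λ { c≈d (t , t≈c) → t , ≈ᴹ-trans t≈c c≈d }
    ; 0-closed   = 𝟘 , ≈ᴹ-refl
    ; +-closed   = λ { (t , t≈c) (u , u≈d) → t ⊕ u , +ᴹ-cong t≈c u≈d }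
    ; neg-closed = λ { (t , t≈c) → ⊖ t , -ᴹ‿cong t≈c }
    ; *-closed   = λ { r (t , t≈c) → r ⊙ t , *ₗ-congˡ t≈c }
    }

  -- If the range of v is closed under the module operations, then its span is presented by
  -- the graphs of addition and of scalar multiplication; by canonical, the relation
  -- 1 · a = scale 1 a identifies generators with equal values.
  module Closed
    (add       : G → G → G)
    (add-≈     : ∀ a b → v (add a b) ≈ᴹ v a +ᴹ v b)
    (scale     : Ring.Carrier R → G → G)
    (scale-≈   : ∀ r a → v (scale r a) ≈ᴹ r *ₗ v a)
    (canonical : ∀ {a b} → v a ≈ᴹ v b → scale R.1# a ≡ scale R.1# b)
    (point     : G)
    where

    Relations : Set ℓ
    Relations = (G × G) ⊎ (R.Carrier × G)

    ρ : Relations → Term {R = R} G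
    ρ (inj₁ (a , b)) = (gen a ⊕ gen b) ⊕ (⊖ gen (add a b))
    ρ (inj₂ (r , a)) = (r ⊙ gen a) ⊕ (⊖ gen (scale r a))

    eval-ρ : ∀ i → eval (ρ i) ≈ᴹ 0ᴹ
    eval-ρ (inj₁ (a , b)) = x≈y⇒x-y≈0 (≈ᴹ-sym (add-≈ a b))
    eval-ρ (inj₂ (r , a)) = x≈y⇒x-y≈0 (≈ᴹ-sym (scale-≈ r a))

    private
      module F = ModuleLemmas (presented {R = R} ρ)

    -- The relations express closure under the operations, which collapses every term to a single
    -- generator.
    reduce : ∀ t → ∃ λ a → _≋_ ρ t (gen a)
    reduce-⊙ : ∀ r t → ∃ λ a → _≋_ ρ (r ⊙ t) (gen a)

    reduce-⊙ r t = let a , t≋a = reduce t in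
      scale r a , ≋-trans (⊙-cong R.refl t≋a) (F.x-y≈0⇒x≈y (rel (inj₂ (r , a))))

    reduce (gen a) = a , ≋-refl
    reduce (t ⊕ u) = let a , t≋a = reduce t ; b , u≋b = reduce u in
      add a b , ≋-trans (⊕-cong t≋a u≋b) (F.x-y≈0⇒x≈y (rel (inj₁ (a , b))))
    -- Zero and negatives have no relations of their own: they are rewritten as multiples by 0 and
    -- by -1. Calling `reduce-⊙` on t keeps the recursion structural.
    reduce 𝟘       = scale R.0# point ,
      ≋-trans (≋-sym (⊙-zeroˡ (gen point))) (F.x-y≈0⇒x≈y (rel (inj₂ (R.0# , point))))
    reduce (⊖ t)   = let a , -1t≋a = reduce-⊙ (R.- R.1#) t in
      a , ≋-trans (≋-sym (F.-1*x≈-x t)) -1t≋a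
    reduce (r ⊙ t) = reduce-⊙ r t

    value-of-member : ∀ {c} → Submodule.Member span c → ∃ λ a → v a ≈ᴹ c
    value-of-member (t , t≈c) = let a , t≋a = reduce t in
      a , ≈ᴹ-trans (≈ᴹ-sym (eval-cong eval-ρ t≋a)) t≈c

    eval-injective : ∀ {t u} → eval t ≈ᴹ eval u → _≋_ ρ t u
    eval-injective {t} {u} t≈u = begin
      t                         ≈⟨ t≋a ⟩
      gen a                     ≈⟨ normal a ⟩
      gen (scale R.1# a)        ≡⟨ cong gen (canonical a≈b) ⟩
      gen (scale R.1# b)        ≈⟨ normal b ⟨
      gen b                     ≈⟨ u≋b ⟨
      u                         ∎
      where
      open ≈-Reasoning F.≈ᴹ-setoid
      a = proj₁ (reduce t)
      t≋a = proj₂ (reduce t)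
      b = proj₁ (reduce u)
      u≋b = proj₂ (reduce u)

      a≈b : v a ≈ᴹ v b
      a≈b = ≈ᴹ-trans (≈ᴹ-sym (eval-cong eval-ρ t≋a)) (≈ᴹ-trans t≈u (eval-cong eval-ρ u≋b))

      normal : ∀ a → _≋_ ρ (gen a) (gen (scale R.1# a))
      normal a = ≋-trans (≋-sym (⊙-identityˡ (gen a))) (F.x-y≈0⇒x≈y (rel (inj₂ (R.1# , a))))

    presented≅span : presented ρ ≅ submodule span
    presented≅span = _ , mkIso (presented ρ) (submodule span) (λ t → eval t , t , ≈ᴹ-refl)
      (mkHom (presented ρ) (submodule span) _ (eval-cong eval-ρ)
        (λ _ _ → ≈ᴹ-refl) (λ _ _ → ≈ᴹ-refl))
      eval-injective
      (λ (c , t , t≈c) → t , t≈c)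

-- Reflection of vanishing Ext¹ to almost all N x

module Reflection (em : ∀ {a} → ExcludedMiddle a) (ext : ∀ {a b} → Extensionality a b)
                  {ℓ} {κ : Set ℓ} (κ-supercompact : IsSupercompact κ)
                  {R : Ring ℓ ℓ} (R≺κ : setoid (Ring.Carrier R) ≺ setoid κ)
                  (C : LeftModule R ℓ ℓ) where
  open Classical em
  open ModuleLemmas C
  open Representatives ext ≈ᴹ-setoid

  -- The copy of κ makes A large enough to carry a measure even if C is small; `⟦_⟧` sends it to 0,
  -- so it adds nothing to spans.
  A : Set ℓ
  A = κ ⊎ Carrierᴹ

  ⟦_⟧ : A → Carrierᴹ
  ⟦ inj₁ _ ⟧ = 0ᴹ
  ⟦ inj₂ c ⟧ = c

  -- Subsets of A need not respect equality in C; coding by representatives gives equal elements of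
  -- C the same code.
  ⌜_⌝ : Carrierᴹ → A
  ⌜ c ⌝ = inj₂ (rep c)

  ⌜⌝-cong : ∀ {c d} → c ≈ᴹ d → ⌜ c ⌝ ≡ ⌜ d ⌝
  ⌜⌝-cong c≈d = cong inj₂ (rep-cong c≈d)

  μ : NormalMeasure κ A
  μ = proj₂ κ-supercompact A (injective⇒≼ inj₁ inj₁-injective)

  open NormalMeasure μ public
  open AlmostAll (proj₁ κ-supercompact) μ public

  Elements : P → Set ℓ
  Elements x = ∃ λ a → T (value x a)

  module N (x : P) = Span C {Elements x} (λ (a , _) → ⟦ a ⟧)

  N : P → Submodule C
  N x = N.span x

  -- These fields meet the requirements of `Span.Closed`, which presents `N x` with fewer than κ
  -- generators and relations.
  record IsClosed (x : P) : Set ℓ where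
    field
      +-closed  : ∀ a → T (value x a) → ∀ b → T (value x b) → T (value x ⌜ ⟦ a ⟧ +ᴹ ⟦ b ⟧ ⌝)
      *-closed  : ∀ r a → T (value x a) → T (value x ⌜ r *ₗ ⟦ a ⟧ ⌝)
      inhabited : T (value x ⌜ 0ᴹ ⌝)

    open N.Closed x
      (λ (a , p) (b , q) → ⌜ ⟦ a ⟧ +ᴹ ⟦ b ⟧ ⌝ , +-closed a p b q)
      (λ _ _ → rep-≈ _)
      (λ r (a , p) → ⌜ r *ₗ ⟦ a ⟧ ⌝ , *-closed r a p)
      (λ _ _ → rep-≈ _)
      (λ a≈b → Σ-T-≡ (⌜⌝-cong (*ₗ-congˡ a≈b)))
      (⌜ 0ᴹ ⌝ , inhabited)
      public

    presented-<κ : submodule (N x) IsLess κ Presented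
    presented-<κ = Elements x , Relations , ρ , value-small x ,
      ⊎-≺ κ-supercompact (×-≺ κ-supercompact (value-small x) (value-small x))
                         (×-≺ κ-supercompact R≺κ (value-small x)) ,
      presented≅span

    -- The set x may contain c in a form other than its code; closure under multiplication by 1
    -- brings in the code.
    representative-∈ : ∀ {c} → Submodule.Member (N x) c → T (value x ⌜ c ⌝)
    representative-∈ c∈N = let (a , p) , a≈c = value-of-member c∈N in
      subst (λ b → T (value x b)) (⌜⌝-cong (≈ᴹ-trans (*ₗ-identityˡ _) a≈c)) (*-closed R.1# a p)

  -- Fineness settles each instance. Diagonal intersections quantify over the elements of x, and
  -- completeness over the scalars, as R is smaller than κ.
  almost-all-closed : U IsClosed
  almost-all-closed =
    zip (λ x (lift +-closed , lift inhabited) (lift *-closed) → record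
           { +-closed = +-closed ; *-closed = *-closed ; inhabited = inhabited })
      (both
        (upward (λ all → lift {ℓ = ℓ} λ a p b q → lower (all a p b q))
          (diagonal _ λ a → diagonal _ λ b → fine ⌜ ⟦ a ⟧ +ᴹ ⟦ b ⟧ ⌝))
        (fine ⌜ 0ᴹ ⌝))
      (upward (λ all → lift {ℓ = ℓ} λ r a p → lower (all r a p))
        (complete _ R≺κ _ λ r → diagonal _ λ a → fine ⌜ r *ₗ ⟦ a ⟧ ⌝))

  contains : ∀ c → U (λ x → Submodule.Member (N x) c)
  contains c = upward (λ {x} p → gen (⌜ c ⌝ , lower p) , rep-≈ c) (fine ⌜ c ⌝)

  -- For closed x the code of any member of `N x` lies in x, so a diagonal intersection reaches all
  -- of `N x`. The conclusion is at `rep c` because `X` need not respect equality in C.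
  almost-all-members : (X : Carrierᴹ → Pred P ℓ) → (∀ c → U (X c)) →
                       U (λ x → ∀ c → Submodule.Member (N x) c → X (rep c) x)
  almost-all-members X uX =
    zip (λ x closed all c c∈N → all ⌜ c ⌝ (IsClosed.representative-∈ closed c∈N))
      almost-all-closed (diagonal (λ a → X ⟦ a ⟧) (λ a → uX ⟦ a ⟧))

  module _ {S : LeftModule R ℓ ℓ} (S≺κ : setoid (LeftModule.Carrierᴹ S) ≺ setoid κ)
           (Ext≈0 : Ext¹[ C , S ]≈0) where
    private
      module S = ModuleLemmas S

    -- The threads form an extension of C by S, a submodule of the ultraproduct of the
    -- extensions 𝓔 x; a section of it is, at almost all x, a section of 𝓔 x.
    module _ (𝓔 : ∀ x → Extension (submodule (N x)) S) where
      private
        module 𝓔 x = Ext (𝓔 x)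
        module E (x : P) = 𝓔.E x

        π : ∀ x → E.Carrierᴹ x → Carrierᴹ
        π x e = proj₁ (𝓔.π x e)

        record Thread : Set ℓ where
          field
            at   : ∀ x → E.Carrierᴹ x
            base : Carrierᴹ
            over : U (λ x → π x (at x) ≈ᴹ base)
        open Thread

        _∼_ : Thread → Thread → Set ℓ
        e ∼ f = U (λ x → E._≈ᴹ_ x (at e x) (at f x))

        threads : LeftModule R ℓ ℓ
        threads = record
          { Carrierᴹ = Thread
          ; _≈ᴹ_ = _∼_
          ; _+ᴹ_ = λ e f → record
            { at   = λ x → E._+ᴹ_ x (at e x) (at f x)
            ; base = base e +ᴹ base f
            ; over = zip (λ x p q → ≈ᴹ-trans (𝓔.π.+ᴹ-homo x _ _) (+ᴹ-cong p q)) (over e) (over f)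
            }
          ; _*ₗ_ = λ r e → record
            { at   = λ x → E._*ₗ_ x r (at e x)
            ; base = r *ₗ base e
            ; over = upward (λ {x} p → ≈ᴹ-trans (𝓔.π.*ₗ-homo x r _) (*ₗ-congˡ p)) (over e)
            }
          ; 0ᴹ = record
            { at   = λ x → E.0ᴹ x
            ; base = 0ᴹ
            ; over = always (λ x → 𝓔.π.0ᴹ-homo x)
            }
          ; -ᴹ_ = λ e → record
            { at   = λ x → E.-ᴹ_ x (at e x)
            ; base = -ᴹ base e
            ; over = upward (λ {x} p → ≈ᴹ-trans (𝓔.π.-ᴹ-homo x _) (-ᴹ‿cong p)) (over e)
            }
          ; isLeftModule = record
            { isLeftSemimodule = record
              { +ᴹ-isCommutativeMonoid = record
                { isMonoid = record
                  { isSemigroup = record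
                    { isMagma = record
                      { isEquivalence = record
                        { refl  = always (λ x → E.≈ᴹ-refl x)
                        ; sym   = upward (λ {x} → E.≈ᴹ-sym x)
                        ; trans = zip (λ x → E.≈ᴹ-trans x)
                        }
                      ; ∙-cong = zip (λ x → E.+ᴹ-cong x)
                      }
                    ; assoc = λ e f g → always (λ x → E.+ᴹ-assoc x _ _ _)
                    }
                  ; identity = (λ e → always (λ x → E.+ᴹ-identityˡ x _))
                             , (λ e → always (λ x → E.+ᴹ-identityʳ x _))
                  }
                ; comm = λ e f → always (λ x → E.+ᴹ-comm x _ _)
                }
              ; isPreleftSemimodule = record
                { *ₗ-cong      = λ r≈s → upward (λ {x} → E.*ₗ-cong x r≈s)
                ; *ₗ-zeroˡ     = λ e → always (λ x → E.*ₗ-zeroˡ x _)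
                ; *ₗ-distribʳ  = λ e r s → always (λ x → E.*ₗ-distribʳ x _ r s)
                ; *ₗ-identityˡ = λ e → always (λ x → E.*ₗ-identityˡ x _)
                ; *ₗ-assoc     = λ r s e → always (λ x → E.*ₗ-assoc x r s _)
                ; *ₗ-zeroʳ     = λ r → always (λ x → E.*ₗ-zeroʳ x r)
                ; *ₗ-distribˡ  = λ r e f → always (λ x → E.*ₗ-distribˡ x r _ _)
                }
              }
            ; -ᴹ‿cong    = upward (λ {x} → E.-ᴹ‿cong x)
            ; -ᴹ‿inverse = (λ e → always (λ x → E.-ᴹ‿inverseˡ x _))
                         , (λ e → always (λ x → E.-ᴹ‿inverseʳ x _))
            }
          }

        -- Although `∼` ignores bases, they agree: at a single good x both are projections of equal
        -- elements.
        base-cong : ∀ {e f} → e ∼ f → base e ≈ᴹ base f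
        base-cong {e} {f} e∼f =
          let x , (πe≈ , πf≈) , e≈f = satisfiable (both (both (over e) (over f)) e∼f)
          in ≈ᴹ-trans (≈ᴹ-sym πe≈) (≈ᴹ-trans (𝓔.π.⟦⟧-cong x e≈f) πf≈)

        constant-thread : S.Carrierᴹ → Thread
        constant-thread s = record
          { at = λ x → 𝓔.ι x s ; base = 0ᴹ ; over = always (λ x → 𝓔.π∘ι≈0 x s) }

        -- Almost every `N x` contains c, and there a preimage exists; 0 fills the remaining null
        -- set.
        thread-over : ∀ c → ∃ λ e → base e ≈ᴹ c
        thread-over c = record
          { at   = λ x → proj₁ (point x)
          ; base = c
          ; over = upward (λ {x} → proj₂ (point x)) (contains c)
          } , ≈ᴹ-refl
          where
          point : ∀ x → ∃ λ e → Submodule.Member (N x) c → π x e ≈ᴹ c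
          point x with em {P = Submodule.Member (N x) c}
          ... | yes c∈N = let e , πe≈ = 𝓔.π-surj x (c , c∈N) in e , λ _ → πe≈ (E.≈ᴹ-refl x)
          ... | no c∉N  = E.0ᴹ x , λ c∈N → ⊥-elim (c∉N c∈N)

        -- At almost every x the thread takes a value coming from S; since S is smaller than κ, one
        -- s serves almost everywhere.
        kernel : ∀ e → base e ≈ᴹ 0ᴹ → ∃ λ s → constant-thread s ∼ e
        kernel e base≈0 =
          let s , F≡s = constant S≺κ (λ x → proj₁ (F x)) in
          s , zip (λ x πe≈ F≡s → subst (λ s → E._≈ᴹ_ x (𝓔.ι x s) (at e x)) F≡s
                                   (proj₂ (F x) (≈ᴹ-trans πe≈ base≈0)))
                (over e) F≡s
          where
          F : ∀ x → ∃ λ s → π x (at e x) ≈ᴹ 0ᴹ → E._≈ᴹ_ x (𝓔.ι x s) (at e x)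
          F x with em {P = π x (at e x) ≈ᴹ 0ᴹ}
          ... | yes πe≈0 = let s , ιs≈e = Equivalence.to (𝓔.exact x _) πe≈0 in s , λ _ → ιs≈e
          ... | no πe≉0  = S.0ᴹ , λ πe≈0 → ⊥-elim (πe≉0 πe≈0)

        thread-extension : Extension C S
        thread-extension = record
          { E      = threads
          ; ι      = constant-thread
          ; π      = base
          ; ι-mono = record
            { isLeftModuleHomomorphism = mkHom S threads constant-thread
                (λ s≈t → always (λ x → 𝓔.ι.⟦⟧-cong x s≈t))
                (λ s t → always (λ x → 𝓔.ι.+ᴹ-homo x s t))
                (λ r s → always (λ x → 𝓔.ι.*ₗ-homo x r s))
            ; injective = λ s∼t → let x , ιs≈ιt = satisfiable s∼t in 𝓔.ι.injective x ιs≈ιt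
            }
          ; π-hom  = mkHom threads C base (λ {e} {f} → base-cong {e} {f})
                       (λ _ _ → ≈ᴹ-refl) (λ _ _ → ≈ᴹ-refl)
          ; π-surj = λ c → let e , e≈c = thread-over c in
              e , λ {f} f∼e → ≈ᴹ-trans (base-cong {f} {e} f∼e) e≈c
          ; exact  = λ e → mk⇔ (kernel e)
              (λ (s , s∼e) → ≈ᴹ-sym (base-cong {constant-thread s} {e} s∼e))
          }

        module τ where
          open Section (split⇒Section (Ext≈0 thread-extension)) public
          open Hom C threads σ-hom public

        _at′_ : Carrierᴹ → ∀ x → E.Carrierᴹ x
        c at′ x = at (τ.σ c) x

      -- Each law of a section holds almost everywhere for fixed arguments; `almost-all-members` and
      -- completeness over R give it for all arguments at once.
      submodule-sections : U (λ x → Section (𝓔 x))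
      submodule-sections =
        zip (λ x (πσ , σ-+) (lift σ-*) → record
              -- `τ.σ` respects equality only up to null sets; evaluating at `rep c` makes the map
              -- respect it at every x.
              { σ      = λ (c , _) → rep c at′ x
              ; σ-hom  = mkHom (submodule (N x)) (𝓔.E x) _
                  (λ {(c , _)} {(d , _)} c≈d → E.≈ᴹ-reflexive x (cong (_at′ x) (rep-cong c≈d)))
                  (λ (c , c∈N) (d , d∈N) → E.≈ᴹ-trans x
                    (E.≈ᴹ-reflexive x (cong (_at′ x) (rep-cong
                      (+ᴹ-cong (≈ᴹ-sym (rep-≈ c)) (≈ᴹ-sym (rep-≈ d))))))
                    (σ-+ c c∈N d d∈N))
                  (λ r (c , c∈N) → E.≈ᴹ-trans x
                    (E.≈ᴹ-reflexive x (cong (_at′ x) (rep-cong (*ₗ-congˡ (≈ᴹ-sym (rep-≈ c))))))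
                    (σ-* r c c∈N))
              ; π∘σ≈id = λ (c , c∈N) → ≈ᴹ-trans (πσ c c∈N) (rep-≈ c)
              })
          (both
            (almost-all-members (λ c x → π x (c at′ x) ≈ᴹ c) (λ c →
              upward (λ πσ≈ → ≈ᴹ-trans πσ≈ (τ.π∘σ≈id c)) (over (τ.σ c))))
            (almost-all-members
              (λ c x → ∀ d → Submodule.Member (N x) d →
                 E._≈ᴹ_ x (rep (c +ᴹ rep d) at′ x) (E._+ᴹ_ x (c at′ x) (rep d at′ x)))
              (λ c → almost-all-members
                (λ d x → E._≈ᴹ_ x (rep (c +ᴹ d) at′ x) (E._+ᴹ_ x (c at′ x) (d at′ x)))
                (λ d → zip (λ x → E.≈ᴹ-trans x) (τ.⟦⟧-cong (rep-≈ (c +ᴹ d))) (τ.+ᴹ-homo c d)))))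
          (upward (lift {ℓ = ℓ})
            (complete _ R≺κ _ λ r → almost-all-members
              (λ c x → E._≈ᴹ_ x (rep (r *ₗ c) at′ x) (E._*ₗ_ x r (c at′ x)))
              (λ c → zip (λ x → E.≈ᴹ-trans x) (τ.⟦⟧-cong (rep-≈ (r *ₗ c))) (τ.*ₗ-homo r c))))

    -- Lift C → C / N x to g x : C → E x.  Its restriction to N x lands in S, so it is almost
    -- everywhere the restriction of one H : C → S, and g x - ι H factors through C / N x.
    module _ (𝓔 : ∀ x → Extension (quotient (N x)) S) where
      private
        module 𝓔 x = Ext (𝓔 x)
        module E (x : P) = 𝓔.E x

        lifts : ∀ x → ∃ λ g → IsHom C (𝓔.E x) g × (∀ c → 𝓔.X._≈ᴹ_ x (𝓔.π x (g c)) c)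
        lifts x = lift-hom Ext≈0 (𝓔 x) {λ c → c}
          (mkHom C (quotient (N x)) _ (quotient-cong x)
            (λ _ _ → 𝓔.X.≈ᴹ-refl x) (λ _ _ → 𝓔.X.≈ᴹ-refl x))
          where
          quotient-cong : ∀ x {c d} → c ≈ᴹ d → 𝓔.X._≈ᴹ_ x c d
          quotient-cong x c≈d =
            Submodule.respects (N x) (≈ᴹ-sym (x≈y⇒x-y≈0 c≈d)) (Submodule.0-closed (N x))

        g : ∀ x → Carrierᴹ → E.Carrierᴹ x
        g x = proj₁ (lifts x)

        module g x = Hom C (𝓔.E x) (proj₁ (proj₂ (lifts x)))

        -- On `N x` the lift projects to zero in the quotient, so exactness gives s; off `N x` the
        -- value 0 is a placeholder.
        coefficient : ∀ c x → ∃ λ s → Submodule.Member (N x) c → E._≈ᴹ_ x (𝓔.ι x s) (g x c)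
        coefficient c x with em {P = Submodule.Member (N x) c}
        ... | no c∉N  = S.0ᴹ , λ c∈N → ⊥-elim (c∉N c∈N)
        ... | yes c∈N =
          let s , ιs≈gc = Equivalence.to (𝓔.exact x (g x c))
                (𝓔.X.≈ᴹ-trans x (proj₂ (proj₂ (lifts x)) c)
                  -- In the quotient, c equals zero when `c +ᴹ -ᴹ 0ᴹ` lies in `N x`.
                  (Submodule.respects (N x)
                    (≈ᴹ-sym (≈ᴹ-trans (+ᴹ-congˡ ε⁻¹≈ε) (+ᴹ-identityʳ c))) c∈N))
          in s , λ _ → ιs≈gc

        limit : ∀ c → ∃ λ s → U (λ x → E._≈ᴹ_ x (𝓔.ι x s) (g x c))
        limit c =
          let s , F≡s = constant S≺κ (λ x → proj₁ (coefficient c x)) in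
          s , zip (λ x F≡s c∈N → subst (λ s → E._≈ᴹ_ x (𝓔.ι x s) (g x c)) F≡s
                                   (proj₂ (coefficient c x) c∈N))
                F≡s (contains c)

        H : Carrierᴹ → S.Carrierᴹ
        H c = proj₁ (limit c)

        -- Each identity is checked at one x where all the limits involved are attained, by
        -- injectivity of ι at x.
        H-hom : IsHom C S H
        H-hom = mkHom C S H
          (λ {c} {d} c≈d →
            let x , p , q = satisfiable (both (proj₂ (limit c)) (proj₂ (limit d))) in
            𝓔.ι.injective x (E.≈ᴹ-trans x p (E.≈ᴹ-trans x (g.⟦⟧-cong x c≈d) (E.≈ᴹ-sym x q))))
          (λ c d →
            let x , (p , q) , r = satisfiable
                  (both (both (proj₂ (limit c)) (proj₂ (limit d))) (proj₂ (limit (c +ᴹ d)))) in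
            𝓔.ι.injective x (E.≈ᴹ-trans x r (E.≈ᴹ-trans x (g.+ᴹ-homo x c d)
              (E.≈ᴹ-sym x (E.≈ᴹ-trans x (𝓔.ι.+ᴹ-homo x _ _) (E.+ᴹ-cong x p q))))))
          (λ r c →
            let x , p , q = satisfiable (both (proj₂ (limit c)) (proj₂ (limit (r *ₗ c)))) in
            𝓔.ι.injective x (E.≈ᴹ-trans x q (E.≈ᴹ-trans x (g.*ₗ-homo x r c)
              (E.≈ᴹ-sym x (E.≈ᴹ-trans x (𝓔.ι.*ₗ-homo x r _) (E.*ₗ-congˡ x p))))))

        module H = Hom C S H-hom

      quotient-sections : U (λ x → Section (𝓔 x))
      quotient-sections =
        upward (λ {x} ιH≈g →
          let ι∘H-hom = mkHom C (𝓔.E x) (λ c → 𝓔.ι x (H c))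
                (λ c≈d → 𝓔.ι.⟦⟧-cong x (H.⟦⟧-cong c≈d))
                (λ c d → E.≈ᴹ-trans x (𝓔.ι.⟦⟧-cong x (H.+ᴹ-homo c d)) (𝓔.ι.+ᴹ-homo x _ _))
                (λ r c → E.≈ᴹ-trans x (𝓔.ι.⟦⟧-cong x (H.*ₗ-homo r c)) (𝓔.ι.*ₗ-homo x r _))
          in record
          -- Subtracting a value of ι leaves the projection unchanged, so this is still a lift.
          { σ      = λ c → E._+ᴹ_ x (g x c) (E.-ᴹ_ x (𝓔.ι x (H c)))
          ; σ-hom  = quotient-hom {M = C} {𝓔.E x} (N x)
              (difference-hom C (𝓔.E x) (proj₁ (proj₂ (lifts x))) ι∘H-hom)
              (λ c c∈N → E.x≈y⇒x-y≈0 x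
                (E.≈ᴹ-trans x (g.⟦⟧-cong x (≈ᴹ-sym (rep-≈ c)))
                  (E.≈ᴹ-trans x (E.≈ᴹ-sym x (ιH≈g c c∈N))
                    (𝓔.ι.⟦⟧-cong x (H.⟦⟧-cong (rep-≈ c))))))
          ; π∘σ≈id = λ c → X.≈ᴹ-trans x (𝓔.π.+ᴹ-homo x _ _)
              (X.≈ᴹ-trans x
                (X.+ᴹ-cong x (proj₂ (proj₂ (lifts x)) c)
                  (X.≈ᴹ-trans x (𝓔.π.-ᴹ-homo x _)
                    (X.≈ᴹ-trans x (X.-ᴹ‿cong x (𝓔.π∘ι≈0 x _)) (X.ε⁻¹≈ε x))))
                (X.+ᴹ-identityʳ x c))
          })
          (almost-all-members (λ c x → E._≈ᴹ_ x (𝓔.ι x (H c)) (g x c)) (λ c → proj₂ (limit c)))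
        where
        module X x = 𝓔.X x

-- Simultaneous reflection for a set of modules

module _ (em : ∀ {a} → ExcludedMiddle a) {ℓ} {R : Ring ℓ ℓ} where
  open Classical em

  -- Vanishing of Ext¹ quantifies over all extensions and exceeds the level that `U` can measure.
  -- Choosing a nonsplit extension whenever there is one reduces it to a section of a single
  -- extension.
  worst-extension : (X C : LeftModule R ℓ ℓ) →
                    ∃ λ (𝓔 : Extension X C) → Section 𝓔 → Ext¹[ X , C ]≈0
  worst-extension X C with em {P = ∃ λ (𝓔 : Extension X C) → ¬ (𝓔 ≃ splitExtension X C)}
  ... | yes (𝓔 , ¬split) = 𝓔 , λ section → ⊥-elim (¬split (Section⇒split section))
  ... | no ∄            = splitExtension X C , λ _ 𝓔 → dne λ ¬split → ∄ (𝓔 , ¬split)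

theorem1p6 : ∀ ℓ →
    (∀ {a} → ExcludedMiddle a) →
    (∀ {a b} → Extensionality a b) →
    ProperClassOfSupercompacts ℓ →
    ∀ (R : Ring ℓ ℓ) (I : Set ℓ) (S : I → LeftModule R ℓ ℓ) →
    IsKaplansky ⊥[ Members S ]
theorem1p6 ℓ em ext supercompacts R I S =
  κ , proj₁ (proj₁ κ-supercompact) , kaplansky
  where
  open Classical em
  open LeftModule using (Carrierᴹ)

  -- One sum of all carriers bounds every `S i` at once; R and I are included because completeness
  -- is applied over both.
  Parameters : Set ℓ
  Parameters = (Ring.Carrier R ⊎ I) ⊎ ∃ λ i → Carrierᴹ (S i)

  κ : Set ℓ
  κ = proj₁ (supercompacts Parameters)

  κ-supercompact : IsSupercompact κ
  κ-supercompact = proj₁ (proj₂ (supercompacts Parameters))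

  small : {D : Set ℓ} (f : D → Parameters) → (∀ {d e} → f d ≡ f e → d ≡ e) → setoid D ≺ setoid κ
  small f f-inj = ≼-≺-trans (injective⇒≼ f f-inj) (proj₂ (proj₂ (supercompacts Parameters)))

  R≺κ : setoid (Ring.Carrier R) ≺ setoid κ
  R≺κ = small (λ r → inj₁ (inj₁ r)) λ { refl → refl }

  I≺κ : setoid I ≺ setoid κ
  I≺κ = small (λ i → inj₁ (inj₂ i)) λ { refl → refl }

  S≺κ : ∀ i → setoid (Carrierᴹ (S i)) ≺ setoid κ
  S≺κ i = small (λ s → inj₂ (i , s)) λ { refl → refl }

  kaplansky : (C : LeftModule R ℓ ℓ) → ⊥[ Members S ] C →
    let open LeftModule C using (_≈ᴹ_; ≈ᴹ-setoid) in
    (X : Pred (Carrierᴹ C) ℓ) → X Respects _≈ᴹ_ →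
    On.setoid {B = Σ (Carrierᴹ C) X} ≈ᴹ-setoid proj₁ ≺ setoid κ →
    ∃ λ (C₀ : Submodule C) →
      (submodule C₀ IsLess κ Presented) ×
      X ⊆ Submodule.Member C₀ ×
      ⊥[ Members S ] (submodule C₀) ×
      ⊥[ Members S ] (quotient C₀)
  kaplansky C C∈⊥ X _ X≺κ =
    -- All requirements hold almost everywhere, for all i together since I is smaller than κ; any
    -- common x gives the submodule.
    let x , (closed , X⊆N) , sub , quot = satisfiable (both (both almost-all-closed contains-X)
          (both (complete I I≺κ _ sub-sections) (complete I I≺κ _ quot-sections)))
    in N x
     , IsClosed.presented-<κ closed
     , (λ {c} c∈X → X⊆N (c , c∈X))
     , (λ { _ (i , refl) → proj₂ (worst-extension em (submodule (N x)) (S i)) (sub i) })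
     , (λ { _ (i , refl) → proj₂ (worst-extension em (quotient (N x)) (S i)) (quot i) })
    where
    open Reflection em ext κ-supercompact R≺κ C

    -- The size of X is bounded only up to equality in C, hence completeness in its setoid form.
    contains-X : U (λ x → ∀ ((c , _) : Σ (Carrierᴹ C) X) → Submodule.Member (N x) c)
    contains-X = complete-setoid _ X≺κ (λ (c , _) x → Submodule.Member (N x) c)
      (λ c≈d {x} → Submodule.respects (N x) c≈d) (λ (c , _) → contains c)

    sub-sections : ∀ i → U (λ x → Section (proj₁ (worst-extension em (submodule (N x)) (S i))))
    sub-sections i = submodule-sections (S≺κ i) (C∈⊥ (S i) (i , refl)) _

    quot-sections : ∀ i → U (λ x → Section (proj₁ (worst-extension em (quotient (N x)) (S i))))
    quot-sections i = quotient-sections (S≺κ i) (C∈⊥ (S i) (i , refl)) _
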